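{- Let $p$ be a prime and let $A,\Gamma\subset\mathbb{F}_p^*$ be two multiplicative subgroups. Suppose that $A-A=\xi\Gamma\sqcup\{0\}$ for some $\xi\in\mathbb{F}_p^*$, and that $(A\circ A)(x)=c$ is a constant for all $x\in\xi\Gamma$. Then $|A|^2-|A|=c|\Gamma|$, and either $|\Gamma|=O(1)$ or $|\Gamma|\gg\frac{p}{\log p}$.
   Context: For a set $A\subseteq\mathbb{F}_p$ (identified with its indicator function), $(A\circ A)(x)=\sum_{y\in\mathbb{F}_p}A(y)A(y+x)=|\{(a,a')\in A^2: a'-a=x\}|$. $X\ll Y$ means $X\le cY$ with an absolute constant $c$. -}

module Defs where

open import Algebra.Properties.Monoid.Sum using (sum-syntax)
open import Data.Bool.Base using (if_then_else_)
open import Data.Fin.Base using (Fin; toℕ)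
open import Data.Fin.Subset using (Subset; _∈_; _∉_)
open import Data.Nat.Base as ℕ using (ℕ; NonZero)
open import Data.Nat.DivMod using (_mod_)
open import Data.Nat.Properties using (+-0-monoid)
open import Data.Product.Base using (∃-syntax; _×_)
open import Data.Vec.Base using (lookup)
open import Level using (0ℓ)
open import Relation.Binary.PropositionalEquality.Core using (_≡_)
open import Relation.Unary using (Pred; _≐_; _∪_; _⊥_)

-- Residues modulo p; this is the prime field when p is prime.
𝔽 : ℕ → Set
𝔽 = Fin

module _ {p : ℕ} .{{_ : NonZero p}} where

  infixl 6 _+_ _-_
  infixl 7 _*_
  infix  8 -_

  0# 1# : 𝔽 p
  0# = 0 mod p
  1# = 1 mod p

  _+_ _*_ : 𝔽 p → 𝔽 p → 𝔽 p
  x + y = (toℕ x ℕ.+ toℕ y) mod p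
  x * y = (toℕ x ℕ.* toℕ y) mod p

  -_ : 𝔽 p → 𝔽 p
  - x = (p ℕ.∸ toℕ x) mod p

  _-_ : 𝔽 p → 𝔽 p → 𝔽 p
  x - y = x + (- y)

  record IsMultiplicativeSubgroup (A : Subset p) : Set where
    field
      0∉       : 0# ∉ A
      1∈       : 1# ∈ A
      *-closed : ∀ {x y} → x ∈ A → y ∈ A → x * y ∈ A
      inverse  : ∀ {x} → x ∈ A → ∃[ y ] (y ∈ A × x * y ≡ 1#)

  infix 6 _⊖_
  infix 7 _⊙_

  _⊖_ : Subset p → Subset p → Pred (𝔽 p) 0ℓ
  (A ⊖ B) x = ∃[ a ] ∃[ b ] (a ∈ A × b ∈ B × x ≡ a - b)

  _⊙_ : 𝔽 p → Subset p → Pred (𝔽 p) 0ℓ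
  (ξ ⊙ A) x = ∃[ a ] (a ∈ A × x ≡ ξ * a)

  𝟙 : Subset p → 𝔽 p → ℕ
  𝟙 A x = if lookup A x then 1 else 0

  infix 7 _⊚_

  -- The correlation Σ_y A(y) B(y + x), not the convolution Σ_y A(y) B(x - y).
  _⊚_ : Subset p → Subset p → 𝔽 p → ℕ
  (A ⊚ B) x = sum-syntax +-0-monoid p λ y → 𝟙 A y ℕ.* 𝟙 B (y + x)

infix 4 _≐_⊔_

_≐_⊔_ : {X : Set} → Pred X 0ℓ → Pred X 0ℓ → Pred X 0ℓ → Set
P ≐ Q ⊔ R = P ≐ (Q ∪ R) × Q ⊥ R

{-# OPTIONS --safe #-}
module Submission where

-- Write a = |A|, n = a − 1, g = |Γ|. Counting pairs of A by their difference gives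
-- a² = a + c g. If p ≤ 2g there is nothing left to prove, and a ≤ 3 forces g ≤ 6; the point is
-- that a ≥ 4 and 2g < p are incompatible.
--
-- A ⊆ Γ, so g = a k, and c k = n. Put S(j) = Σ_{b∈A} b (1 − b)^j. Power sums over A vanish
-- off the multiples of a, so S(j) = 0 for j < n, and (1 − b)^g = ξ^g for b ≠ 1 gives
-- S(g + j) = ξ^g S(j) for j ≥ 1 and S(g) = −ξ^g ≠ 0. Following Stepanov and
-- Hanson–Petridis, consider Σ_{b∈A} b (X − b)^(g+n). Only exponents divisible by a occur in it,
-- so applying Π_{j<d} (X d/dX − a j) and setting X = 1 gives 0 for every d > k. Rewritten in
-- falling factorials, the same value is a combination of S(g + n), …, S(g + n − d). For d = n it is
-- a nonzero multiple of S(g), so k ≥ n, hence k = n. For d = n + 1 and d = n + 2 it gives two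
-- linear relations between S(g), S(g − 1), S(g − 2); expanding b^a = (1 − (1 − b))^a gives a third,
-- and eliminating leaves n² (n + 1)² (n + 2) (n − 2) = 0 in 𝔽_p, which is false for 3 ≤ n < p − 2.

open import Algebra.Bundles using (CommutativeMonoid; CommutativeRing)
import Algebra.Definitions.RawMonoid
import Algebra.Properties.CommutativeMonoid.Sum
import Algebra.Properties.Semiring.Sum
open import Algebra.Structures using (IsCommutativeRing)
open import Data.Bool.Base using (true; false; if_then_else_)
open import Data.Empty using (⊥)
open import Data.Fin.Base using (Fin; zero; suc; toℕ)
open import Data.Fin.Permutation using (Permutation′; permutation)
open import Data.Fin.Properties using (toℕ<n; toℕ-injective; toℕ-fromℕ<; _≟_)
open import Data.Fin.Subset using (Subset; ∣_∣; outside)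
open import Data.Fin.Subset.Properties
  using (_∈?_; nonempty?; Empty-unique; ∣⊥∣≡0; ∣⁅x⁆∣≡1; p⊆q⇒∣p∣≤∣q∣; x∈⁅y⁆⇒x≡y)
open import Data.Integer.Base as ℤ using (ℤ) renaming (+_ to pos)
import Data.Integer.Properties as ℤ
open import Data.Maybe.Base using (map)
open import Data.Nat.Base as ℕ using (ℕ; zero; suc; _∸_; s≤s; z≤n; _≤_; _<_; NonZero)
open import Data.Nat.Combinatorics using (_C_; nCk+nC[k+1]≡[n+1]C[k+1]; nC1≡n)
open import Data.Nat.Coprimality using (coprime-Bézout; prime⇒coprime)
open import Data.Nat.DivMod
  using (_%_; _/_; _mod_; m%n<n; %-distribˡ-+; %-distribˡ-*; n%n≡0; m<n⇒m%n≡m; m≡m%n+[m/n]*n)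
open import Data.Nat.Divisibility
  using (_∣_; _∣?_; divides; ∣⇒≤; ∣m+n∣m⇒∣n; m%n≡0⇒n∣m; n∣m⇒m%n≡0)
open import Data.Nat.GCD using (module Bézout)
open import Data.Nat.Logarithm using (⌊log₂_⌋; ⌊log₂⌋-mono-≤)
open import Data.Nat.Primality using (Prime; euclidsLemma; prime⇒nonTrivial)
import Data.Nat.Properties as ℕ
open import Data.Nat.Solver using (module +-*-Solver)
open import Data.Product.Base using (∃-syntax; _×_; _,_; proj₁; proj₂)
open import Data.Sum.Base using (_⊎_; inj₁; inj₂; [_,_]′)
open import Data.Vec.Base using (Vec; []; _∷_; lookup; replicate; _[_]≔_)
open import Data.Vec.Properties using ([]=⇒lookup; lookup⇒[]=; lookup∘update; lookup∘update′)
import Defs as D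
open import Defs using (𝔽; IsMultiplicativeSubgroup)
open import Function.Base using (_∘_; case_of_)
open import Level using (0ℓ)
open import Relation.Binary.PropositionalEquality
  using (_≡_; _≢_; refl; sym; trans; cong; cong₂; subst; isEquivalence; module ≡-Reasoning)
open import Relation.Nullary using (¬_; Dec; yes; no; does; contradiction)
open import Relation.Nullary.Decidable using (dec-true; dec-false; dec⇒maybe)

open +-*-Solver using ()
  renaming (solve to solveℕ; con to conℕ; _:+_ to _:+ℕ_; _:*_ to _:*ℕ_; _:=_ to _:=ℕ_)

-- Ring solver with integer coefficients

-- The ring solver compares coefficients, so they are taken in ℤ, where equality computes.
module IntegerCoefficients {c ℓ} (R : CommutativeRing c ℓ) where

  open import Data.Integer.Base using (+_; -[1+_]; _⊖_)
  open CommutativeRing R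
    renaming (refl to ≈-refl; sym to ≈-sym; trans to ≈-trans; reflexive to ≈-reflexive)
  open import Algebra.Properties.Ring ring
  open import Algebra.Properties.Semiring.Mult.TCOptimised semiring using (1+×; ×-homo-+; ×1-homo-*)
    renaming (_×_ to _·_)
  open import Algebra.Solver.Ring.AlmostCommutativeRing
  open import Relation.Binary.Reasoning.Setoid setoid

  ⟦_⟧ : ℤ → Carrier
  ⟦ + n ⟧      = n · 1#
  ⟦ -[1+ n ] ⟧ = - (suc n · 1#)

  ⟦⟧-neg : ∀ i → ⟦ ℤ.- i ⟧ ≈ - ⟦ i ⟧
  ⟦⟧-neg (+ zero)  = ≈-sym -0#≈0#
  ⟦⟧-neg (+ suc n) = ≈-refl
  ⟦⟧-neg -[1+ n ]  = ≈-sym (-‿involutive _)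

  ⟦⟧-⊖ : ∀ m n → ⟦ m ⊖ n ⟧ ≈ m · 1# - n · 1#
  ⟦⟧-⊖ zero    zero    = ≈-sym (-‿inverseʳ 0#)
  ⟦⟧-⊖ zero    (suc n) = ≈-sym (+-identityˡ _)
  ⟦⟧-⊖ (suc m) zero    = ≈-sym (≈-trans (+-congˡ -0#≈0#) (+-identityʳ _))
  ⟦⟧-⊖ (suc m) (suc n) = begin
    ⟦ suc m ⊖ suc n ⟧                    ≡⟨ cong ⟦_⟧ (ℤ.[1+m]⊖[1+n]≡m⊖n m n) ⟩
    ⟦ m ⊖ n ⟧                            ≈⟨ ⟦⟧-⊖ m n ⟩
    m · 1# - n · 1#                      ≈⟨ +-congʳ (+-identityʳ _) ⟨
    m · 1# + 0# - n · 1#                 ≈⟨ +-congʳ (+-congˡ (-‿inverseʳ 1#)) ⟨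
    m · 1# + (1# - 1#) - n · 1#          ≈⟨ +-congʳ (+-assoc _ _ _) ⟨
    m · 1# + 1# - 1# - n · 1#            ≈⟨ +-assoc _ _ _ ⟩
    m · 1# + 1# + (- 1# - n · 1#)        ≈⟨ +-cong (+-comm _ _) (-‿+-comm _ _) ⟩
    1# + m · 1# - (1# + n · 1#)          ≈⟨ +-cong (1+× m 1#) (-‿cong (1+× n 1#)) ⟨
    suc m · 1# - suc n · 1#              ∎

  ⟦⟧-+ : ∀ i j → ⟦ i ℤ.+ j ⟧ ≈ ⟦ i ⟧ + ⟦ j ⟧
  ⟦⟧-+ (+ m)    (+ n)    = ×-homo-+ 1# m n
  ⟦⟧-+ (+ m)    -[1+ n ] = ⟦⟧-⊖ m (suc n)
  ⟦⟧-+ -[1+ m ] (+ n)    = ≈-trans (⟦⟧-⊖ n (suc m)) (+-comm _ _)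
  ⟦⟧-+ -[1+ m ] -[1+ n ] = begin
    - (suc (suc (m ℕ.+ n)) · 1#)        ≡⟨ cong (λ k → - (suc k · 1#)) (ℕ.+-suc m n) ⟨
    - ((suc m ℕ.+ suc n) · 1#)          ≈⟨ -‿cong (×-homo-+ 1# (suc m) (suc n)) ⟩
    - (suc m · 1# + suc n · 1#)         ≈⟨ -‿+-comm _ _ ⟨
    - (suc m · 1#) - suc n · 1#         ∎

  ⟦⟧-*-pos : ∀ m j → ⟦ + m ℤ.* j ⟧ ≈ m · 1# * ⟦ j ⟧
  ⟦⟧-*-pos m (+ n) = ≈-trans (≈-reflexive (cong ⟦_⟧ (sym (ℤ.pos-* m n)))) (×1-homo-* m n)
  ⟦⟧-*-pos m -[1+ n ] = begin
    ⟦ + m ℤ.* -[1+ n ] ⟧            ≡⟨ cong ⟦_⟧ (ℤ.neg-distribʳ-* (+ m) (+ suc n)) ⟨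
    ⟦ ℤ.- (+ m ℤ.* + suc n) ⟧       ≈⟨ ⟦⟧-neg (+ m ℤ.* + suc n) ⟩
    - ⟦ + m ℤ.* + suc n ⟧           ≈⟨ -‿cong (⟦⟧-*-pos m (+ suc n)) ⟩
    - (m · 1# * (suc n · 1#))       ≈⟨ -‿distribʳ-* _ _ ⟩
    m · 1# * - (suc n · 1#)         ∎

  ⟦⟧-* : ∀ i j → ⟦ i ℤ.* j ⟧ ≈ ⟦ i ⟧ * ⟦ j ⟧
  ⟦⟧-* (+ m)    j = ⟦⟧-*-pos m j
  ⟦⟧-* -[1+ m ] j = begin
    ⟦ -[1+ m ] ℤ.* j ⟧              ≡⟨ cong ⟦_⟧ (ℤ.neg-distribˡ-* (+ suc m) j) ⟨
    ⟦ ℤ.- (+ suc m ℤ.* j) ⟧         ≈⟨ ⟦⟧-neg (+ suc m ℤ.* j) ⟩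
    - ⟦ + suc m ℤ.* j ⟧             ≈⟨ -‿cong (⟦⟧-*-pos (suc m) j) ⟩
    - (suc m · 1# * ⟦ j ⟧)          ≈⟨ -‿distribˡ-* _ _ ⟩
    - (suc m · 1#) * ⟦ j ⟧          ∎

  ⟦⟧-homo : ℤ.+-*-rawRing -Raw-AlmostCommutative⟶ fromCommutativeRing R
  ⟦⟧-homo = record
    { ⟦_⟧    = ⟦_⟧
    ; +-homo = ⟦⟧-+
    ; *-homo = ⟦⟧-*
    ; -‿homo = ⟦⟧-neg
    ; 0-homo = ≈-refl
    ; 1-homo = ≈-refl
    }

  open import Algebra.Solver.Ring ℤ.+-*-rawRing (fromCommutativeRing R) ⟦⟧-homo
    (λ i j → map (λ i≡j → ≈-reflexive (cong ⟦_⟧ i≡j)) (dec⇒maybe (i ℤ.≟ j))) public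
    using (Polynomial; con; _:+_; _:*_; _:-_; :-_; _:=_; solve)

  nat : ∀ {n} → ℕ → Polynomial n
  nat k = con (+ k)

-- Absorption for binomial coefficients

-- Induction through Pascal's rule: once one copy of `x` is split off, both remaining summands are
-- instances of the induction hypothesis, and Pascal's rule recombines them.
[1+k]*[1+n]C[1+k]≡[1+n]*nCk : ∀ n k → suc k ℕ.* (suc n C suc k) ≡ suc n ℕ.* (n C k)
[1+k]*[1+n]C[1+k]≡[1+n]*nCk n zero =
  trans (ℕ.+-identityʳ _) (trans (nC1≡n (suc n)) (sym (ℕ.*-identityʳ (suc n))))
[1+k]*[1+n]C[1+k]≡[1+n]*nCk zero (suc k) = ℕ.*-zeroʳ (suc (suc k))
[1+k]*[1+n]C[1+k]≡[1+n]*nCk (suc n) (suc k) = begin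
  (2 ℕ.+ k) ℕ.* (suc (suc n) C suc (suc k))
    ≡⟨ cong ((2 ℕ.+ k) ℕ.*_) (nCk+nC[k+1]≡[n+1]C[k+1] (suc n) (suc k)) ⟨
  (2 ℕ.+ k) ℕ.* (x ℕ.+ z)
    ≡⟨ solve 3 (λ k x z → (con 2 :+ k) :* (x :+ z) := x :+ ((con 1 :+ k) :* x :+ (con 2 :+ k) :* z))
      refl k x z ⟩
  x ℕ.+ (suc k ℕ.* x ℕ.+ (2 ℕ.+ k) ℕ.* z)
    ≡⟨ cong (x ℕ.+_) (cong₂ ℕ._+_ ([1+k]*[1+n]C[1+k]≡[1+n]*nCk n k)
      ([1+k]*[1+n]C[1+k]≡[1+n]*nCk n (suc k))) ⟩
  x ℕ.+ (suc n ℕ.* (n C k) ℕ.+ suc n ℕ.* (n C suc k))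
    ≡⟨ cong (x ℕ.+_) (ℕ.*-distribˡ-+ (suc n) (n C k) (n C suc k)) ⟨
  x ℕ.+ suc n ℕ.* ((n C k) ℕ.+ (n C suc k))
    ≡⟨ cong (λ t → x ℕ.+ suc n ℕ.* t) (nCk+nC[k+1]≡[n+1]C[k+1] n k) ⟩
  suc (suc n) ℕ.* x ∎
  where
  open +-*-Solver
  open ≡-Reasoning
  x = suc n C suc k
  z = suc n C suc (suc k)

-- Falling factorials and binomial sums in a commutative ring

module PropositionalRing
  {F : Set} {_⊕_ _⊛_ : F → F → F} {⊝_ : F → F} {𝟎 𝟏 : F}
  (isCommutativeRing : IsCommutativeRing _≡_ _⊕_ _⊛_ ⊝_ 𝟎 𝟏)
  where

  open ≡-Reasoning

  R : CommutativeRing 0ℓ 0ℓ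
  R = record { isCommutativeRing = isCommutativeRing }

  open CommutativeRing R public
    using (_+_; _*_; -_; _-_; 0#; 1#; +-identityˡ; +-identityʳ; *-identityˡ; *-identityʳ; zeroˡ; zeroʳ
          ; +-assoc; *-assoc; +-comm; *-comm; -‿inverseʳ; -‿inverseˡ; distribˡ
          ; semiring; commutativeSemiring; ring; +-commutativeMonoid; *-commutativeMonoid)
  open import Algebra.Properties.Semiring.Sum semiring public
  open import Algebra.Properties.Semiring.Mult semiring public
    using (×-homo-+; ×1-homo-*; ×-assoc-*) renaming (_×_ to _·_)
  open import Algebra.Properties.CommutativeSemiring.Exp commutativeSemiring public
  open import Algebra.Properties.CommutativeSemiring.Binomial commutativeSemiring using (theorem)
  open import Algebra.Properties.Ring ring public using (x∙y⁻¹≈ε⇒x≈y)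
  open IntegerCoefficients R public using (⟦_⟧; nat; _:+_; _:*_; _:-_; :-_; _:=_; solve)

  ι : ℕ → F
  ι n = n · 1#

  1^n≡1 : ∀ n → 1# ^ n ≡ 1#
  1^n≡1 zero    = refl
  1^n≡1 (suc n) = trans (*-identityˡ _) (1^n≡1 n)

  [-x]^n≡[-1]^n*x^n : ∀ x n → (- x) ^ n ≡ (- 1#) ^ n * x ^ n
  [-x]^n≡[-1]^n*x^n x n = begin
    (- x) ^ n              ≡⟨ cong (_^ n) (solve 1 (λ x → :- x := :- nat 1 :* x) refl x) ⟩
    (- 1# * x) ^ n         ≡⟨ ^-distrib-* (- 1#) x n ⟩
    (- 1#) ^ n * x ^ n     ∎

  sum-zero : ∀ {n} (f : Fin n → F) → (∀ i → f i ≡ 0#) → sum f ≡ 0#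
  sum-zero {n} f f≡0 = trans (sum-cong-≗ f≡0) (sum-replicate-zero n)

  binomial : ∀ n x y → ∑[ i ≤ n ] (ι (n C toℕ i) * (x ^ toℕ i * y ^ (n ∸ toℕ i))) ≡ (x + y) ^ n
  binomial n x y = sym (trans (theorem n x y) (sum-cong-≗ {suc n} λ i →
    trans (cong ((n C toℕ i) ·_) (sym (*-identityˡ _)))
          (sym (×-assoc-* (n C toℕ i) 1# (x ^ toℕ i * y ^ (n ∸ toℕ i))))))

  infixl 9 _↓_

  -- The falling factorial. Recursion peels off the leading factor, the one that absorption trades
  -- for a binomial coefficient; `↓-suc` peels off the last factor instead.
  _↓_ : F → ℕ → F
  x ↓ zero  = 1#
  x ↓ suc m = x * (x - 1#) ↓ m

  ↓-suc : ∀ x m → x ↓ suc m ≡ x ↓ m * (x - ι m)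
  ↓-suc x zero    = solve 1 (λ x → x :* nat 1 := nat 1 :* (x :- nat 0)) refl x
  ↓-suc x (suc m) = begin
    x * (x - 1#) ↓ suc m                ≡⟨ cong (x *_) (↓-suc (x - 1#) m) ⟩
    x * ((x - 1#) ↓ m * (x - 1# - ι m))
      ≡⟨ solve 3 (λ x p k → x :* (p :* (x :- nat 1 :- k)) := (x :* p) :* (x :- (nat 1 :+ k))) refl x
        ((x - 1#) ↓ m) (ι m) ⟩
    x ↓ suc m * (x - ι (suc m))         ∎

  0↓1+m≡0 : ∀ m → 0# ↓ suc m ≡ 0#
  0↓1+m≡0 m = zeroˡ _

  ι-suc-1 : ∀ n → ι (suc n) - 1# ≡ ι n
  ι-suc-1 n = solve 1 (λ k → nat 1 :+ k :- nat 1 := k) refl (ι n)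

  ι-absorb : ∀ n k → ι (suc n C suc k) * ι (suc k) ≡ ι (suc n) * ι (n C k)
  ι-absorb n k = begin
    ι (suc n C suc k) * ι (suc k)     ≡⟨ *-comm _ _ ⟩
    ι (suc k) * ι (suc n C suc k)     ≡⟨ ×1-homo-* (suc k) (suc n C suc k) ⟨
    ι (suc k ℕ.* (suc n C suc k))     ≡⟨ cong ι ([1+k]*[1+n]C[1+k]≡[1+n]*nCk n k) ⟩
    ι (suc n ℕ.* (n C k))             ≡⟨ ×1-homo-* (suc n) (n C k) ⟩
    ι (suc n) * ι (n C k)             ∎

  ιC₂ : ∀ n → ι (suc n C 2) * ι 2 ≡ ι (suc n) * ι n
  ιC₂ n = trans (ι-absorb n 1) (cong (λ u → ι (suc n) * ι u) (nC1≡n n))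

  -- The denominators stay on the left, since a general commutative ring has no division. Absorption
  -- at the top reduces the claim to `ιC₂`.
  ιC₃ : ∀ n → ι (suc n C 3) * ι 3 * ι 2 ≡ ι (suc n) * (ι n * (ι n - 1#))
  ιC₃ zero    = solve 2 (λ x y → nat 0 :* x :* y := (nat 1 :+ nat 0) :* (nat 0 :* (nat 0 :- nat 1))) refl
    (ι 3) (ι 2)
  ιC₃ (suc n) = begin
    ι (suc (suc n) C 3) * ι 3 * ι 2               ≡⟨ cong (_* ι 2) (ι-absorb (suc n) 2) ⟩
    ι (suc (suc n)) * ι (suc n C 2) * ι 2         ≡⟨ *-assoc _ _ _ ⟩
    ι (suc (suc n)) * (ι (suc n C 2) * ι 2)       ≡⟨ cong (ι (suc (suc n)) *_) (ιC₂ n) ⟩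
    ι (suc (suc n)) * (ι (suc n) * ι n)
      ≡⟨ cong (λ u → ι (suc (suc n)) * (ι (suc n) * u)) (ι-suc-1 n) ⟨
    ι (suc (suc n)) * (ι (suc n) * (ι (suc n) - 1#)) ∎

  -- This is `X^m (d/dX)^m` applied to the expansion of `(X + y)^n` and evaluated at `X = 1`. Each
  -- step absorbs one factor of the falling factorial into the binomial coefficient. For `m > n` the
  -- truncated exponent is harmless, because `ι n ↓ m` is then 0.
  binomial-↓ : ∀ m n y →
    ∑[ i ≤ n ] (ι (n C toℕ i) * (ι (toℕ i) ↓ m * y ^ (n ∸ toℕ i))) ≡ ι n ↓ m * (1# + y) ^ (n ∸ m)
  binomial-↓ zero n y = begin
    ∑[ i ≤ n ] (ι (n C toℕ i) * (1# * y ^ (n ∸ toℕ i)))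
      ≡⟨ sum-cong-≗ {suc n} (λ i → cong (λ u → ι (n C toℕ i) * (u * y ^ (n ∸ toℕ i)))
        (sym (1^n≡1 (toℕ i)))) ⟩
    ∑[ i ≤ n ] (ι (n C toℕ i) * (1# ^ toℕ i * y ^ (n ∸ toℕ i)))
      ≡⟨ binomial n 1# y ⟩
    (1# + y) ^ n
      ≡⟨ *-identityˡ _ ⟨
    1# * (1# + y) ^ n ∎
  binomial-↓ (suc m) zero y = begin
    _ ≡⟨ cong (λ u → ι 1 * (u * 1#) + 0#) (0↓1+m≡0 m) ⟩
    _ ≡⟨ solve 1 (λ z → z :* (nat 0 :* nat 1) :+ nat 0 := nat 0 :* nat 1) refl (ι 1) ⟩
    0# * 1# ≡⟨ cong (_* 1#) (0↓1+m≡0 m) ⟨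
    _ ∎
  binomial-↓ (suc m) (suc n) y = begin
    ι 1 * (0# ↓ suc m * y ^ suc n) + sum tl
      ≡⟨ cong₂ (λ u v → ι 1 * (u * y ^ suc n) + v) (0↓1+m≡0 m) (sum-cong-≗ {suc n} term) ⟩
    ι 1 * (0# * y ^ suc n) + ∑[ i ≤ n ] (ι (suc n) * t i)
      ≡⟨ solve 3 (λ a b c → a :* (nat 0 :* b) :+ c := c) refl (ι 1) (y ^ suc n)
        (∑[ i ≤ n ] (ι (suc n) * t i)) ⟩
    ∑[ i ≤ n ] (ι (suc n) * t i)
      ≡⟨ *-distribˡ-sum (ι (suc n)) t ⟨
    ι (suc n) * sum t
      ≡⟨ cong (ι (suc n) *_) (binomial-↓ m n y) ⟩
    ι (suc n) * (ι n ↓ m * (1# + y) ^ (n ∸ m))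
      ≡⟨ *-assoc _ _ _ ⟨
    ι (suc n) * ι n ↓ m * (1# + y) ^ (n ∸ m)
      ≡⟨ cong (λ u → ι (suc n) * u ↓ m * (1# + y) ^ (n ∸ m)) (ι-suc-1 n) ⟨
    ι (suc n) ↓ suc m * (1# + y) ^ (n ∸ m) ∎
    where
    t tl : Fin (suc n) → F
    t i = ι (n C toℕ i) * (ι (toℕ i) ↓ m * y ^ (n ∸ toℕ i))
    tl i = ι (suc n C suc (toℕ i)) * (ι (suc (toℕ i)) ↓ suc m * y ^ (n ∸ toℕ i))
    term : ∀ i → tl i ≡ ι (suc n) * t i
    term i = begin
      ι (suc n C suc k) * (ι (suc k) * (ι (suc k) - 1#) ↓ m * y ^ (n ∸ k))
        ≡⟨ cong (λ u → ι (suc n C suc k) * (ι (suc k) * u ↓ m * y ^ (n ∸ k))) (ι-suc-1 k) ⟩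
      ι (suc n C suc k) * (ι (suc k) * ι k ↓ m * y ^ (n ∸ k))
        ≡⟨ solve 4 (λ a b c d → a :* (b :* c :* d) := (a :* b) :* (c :* d)) refl (ι (suc n C suc k))
          (ι (suc k)) (ι k ↓ m) (y ^ (n ∸ k)) ⟩
      ι (suc n C suc k) * ι (suc k) * (ι k ↓ m * y ^ (n ∸ k))
        ≡⟨ cong (_* (ι k ↓ m * y ^ (n ∸ k))) (ι-absorb n k) ⟩
      ι (suc n) * ι (n C k) * (ι k ↓ m * y ^ (n ∸ k))
        ≡⟨ *-assoc _ _ _ ⟩
      ι (suc n) * t i ∎
      where k = toℕ i

  module IntegralDomain (integral : ∀ {x y} → x * y ≡ 0# → x ≡ 0# ⊎ y ≡ 0#) where

    cancelˡ : ∀ {x y} → x ≢ 0# → x * y ≡ 0# → y ≡ 0#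
    cancelˡ x≢0 xy≡0 = [ (λ x≡0 → contradiction x≡0 x≢0) , (λ y≡0 → y≡0) ]′ (integral xy≡0)

    *-≢0 : ∀ {x y} → x ≢ 0# → y ≢ 0# → x * y ≢ 0#
    *-≢0 x≢0 y≢0 xy≡0 = y≢0 (cancelˡ x≢0 xy≡0)

  -- Power sums and differential operators on the Stepanov polynomial

  -- Used with w the indicator of A and b the identity, so that L h = Σ_{x∈A} h x.
  module PowerSums {N : ℕ} (w b : Fin N → F) where

    L : (F → F) → F
    L h = ∑[ i < N ] (w i * h (b i))

    P S : ℕ → F
    P j = L (_^ j)
    S j = L (λ x → x * (1# - x) ^ j)

    L-cong : ∀ {h h′} → (∀ x → h x ≡ h′ x) → L h ≡ L h′
    L-cong h≗h′ = sum-cong-≗ (λ i → cong (w i *_) (h≗h′ (b i)))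

    L-∑ : ∀ {m} (c : Fin m → F) (h : Fin m → F → F) →
          L (λ x → ∑[ j < m ] (c j * h j x)) ≡ ∑[ j < m ] (c j * L (h j))
    L-∑ {m} c h = begin
      ∑[ i < N ] (w i * ∑[ j < m ] (c j * h j (b i)))
        ≡⟨ sum-cong-≗ (λ i → *-distribˡ-sum (w i) (λ j → c j * h j (b i))) ⟩
      ∑[ i < N ] ∑[ j < m ] (w i * (c j * h j (b i)))
        ≡⟨ ∑-comm (λ i j → w i * (c j * h j (b i))) ⟩
      ∑[ j < m ] ∑[ i < N ] (w i * (c j * h j (b i)))
        ≡⟨ sum-cong-≗ (λ j → sum-cong-≗ (λ i → solve 3 (λ x y z → x :* (y :* z) := y :* (x :* z)) refl (w i)
          (c j) (h j (b i)))) ⟩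
      ∑[ j < m ] ∑[ i < N ] (c j * (w i * h j (b i)))
        ≡⟨ sum-cong-≗ (λ j → sym (*-distribˡ-sum (c j) (λ i → w i * h j (b i)))) ⟩
      ∑[ j < m ] (c j * L (h j)) ∎

    -- The coefficient of X^i in Σ_{x∈A} x (X − x)^n; thus Λ n e applies e(X d/dX) and sets X = 1.
    coeff : ℕ → ℕ → F
    coeff n i = ι (n C i) * ((- 1#) ^ (n ∸ i) * P (suc (n ∸ i)))

    Λ : ℕ → (ℕ → F) → F
    Λ n e = ∑[ i ≤ n ] (e (toℕ i) * coeff n (toℕ i))

    Λ-cong : ∀ n {e e′} → (∀ i → e i ≡ e′ i) → Λ n e ≡ Λ n e′
    Λ-cong n e≗e′ = sum-cong-≗ {suc n} (λ i → cong (_* coeff n (toℕ i)) (e≗e′ (toℕ i)))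

    Λ-+* : ∀ n e c e′ → Λ n (λ i → e i + c * e′ i) ≡ Λ n e + c * Λ n e′
    Λ-+* n e c e′ = begin
      Λ n (λ i → e i + c * e′ i)
        ≡⟨ sum-cong-≗ {suc n} (λ i → solve 4 (λ x c y u → (x :+ c :* y) :* u := x :* u :+ c :* (y :* u))
          refl (e (toℕ i)) c (e′ (toℕ i)) (coeff n (toℕ i))) ⟩
      ∑[ i ≤ n ] (e (toℕ i) * coeff n (toℕ i) + c * (e′ (toℕ i) * coeff n (toℕ i)))
        ≡⟨ ∑-distrib-+ {suc n} (λ i → e (toℕ i) * coeff n (toℕ i))
          (λ i → c * (e′ (toℕ i) * coeff n (toℕ i))) ⟩
      Λ n e + ∑[ i ≤ n ] (c * (e′ (toℕ i) * coeff n (toℕ i)))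
        ≡⟨ cong (Λ n e +_) (*-distribˡ-sum {suc n} c (λ i → e′ (toℕ i) * coeff n (toℕ i))) ⟨
      Λ n e + c * Λ n e′ ∎

    -- In the main application the weight `e` kills the exponents divisible by `a`, and the power
    -- sums kill the others.
    Λ-vanishes : ∀ n e → (∀ i → i ≤ n → e i ≡ 0# ⊎ P (suc (n ∸ i)) ≡ 0#) → Λ n e ≡ 0#
    Λ-vanishes n e vanish = sum-zero {suc n} _ λ i → case (vanish (toℕ i) (ℕ.≤-pred (toℕ<n i)))
      (ι (n C toℕ i)) ((- 1#) ^ (n ∸ toℕ i))
      where
      case : ∀ {x z} → x ≡ 0# ⊎ z ≡ 0# → ∀ y s → x * (y * (s * z)) ≡ 0#
      case (inj₁ refl) y s = zeroˡ _
      case {x} (inj₂ refl) y s = solve 3 (λ x y s → x :* (y :* (s :* nat 0)) := nat 0) refl x y s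

    -- Falling factorials are the weights that can be evaluated: by `binomial-↓` with `y = - x`, the
    -- operator turns `(X - x)^n` into a multiple of `(1 - x)^(n - m)`, whose weighted sum is a
    -- value of `S`.
    Λ-↓ : ∀ n m → Λ n (λ i → ι i ↓ m) ≡ ι n ↓ m * S (n ∸ m)
    Λ-↓ n m = begin
      Λ n (λ i → ι i ↓ m)
        ≡⟨ sum-cong-≗ {suc n} (λ i → solve 4 (λ x y z u → x :* (y :* (z :* u)) := x :* y :* z :* u) refl
          (ι (toℕ i) ↓ m) (ι (n C toℕ i)) ((- 1#) ^ (n ∸ toℕ i)) (P (suc (n ∸ toℕ i)))) ⟩
      ∑[ i ≤ n ] (c i * P (suc (n ∸ toℕ i)))
        ≡⟨ L-∑ c (λ i → _^ suc (n ∸ toℕ i)) ⟨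
      L (λ x → ∑[ i ≤ n ] (c i * x ^ suc (n ∸ toℕ i)))
        ≡⟨ L-cong expand ⟩
      L (λ x → ι n ↓ m * (x * (1# - x) ^ (n ∸ m)))
        ≡⟨ sum-cong-≗ (λ i → solve 3 (λ x y z → x :* (y :* z) := y :* (x :* z)) refl (w i) (ι n ↓ m)
          (b i * (1# - b i) ^ (n ∸ m))) ⟩
      ∑[ i < N ] (ι n ↓ m * (w i * (b i * (1# - b i) ^ (n ∸ m))))
        ≡⟨ *-distribˡ-sum (ι n ↓ m) (λ i → w i * (b i * (1# - b i) ^ (n ∸ m))) ⟨
      ι n ↓ m * S (n ∸ m) ∎
      where
      c : Fin (suc n) → F
      c i = ι (toℕ i) ↓ m * ι (n C toℕ i) * (- 1#) ^ (n ∸ toℕ i)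
      expand : ∀ x → ∑[ i ≤ n ] (c i * x ^ suc (n ∸ toℕ i)) ≡ ι n ↓ m * (x * (1# - x) ^ (n ∸ m))
      expand x = begin
        ∑[ i ≤ n ] (c i * (x * x ^ (n ∸ toℕ i)))
          ≡⟨ sum-cong-≗ {suc n}
            (λ i → solve 5 (λ p q s x u → (p :* q :* s) :* (x :* u) := x :* (q :* (p :* (s :* u)))) refl
            (ι (toℕ i) ↓ m) (ι (n C toℕ i)) ((- 1#) ^ (n ∸ toℕ i)) x (x ^ (n ∸ toℕ i))) ⟩
        ∑[ i ≤ n ] (x * (ι (n C toℕ i) * (ι (toℕ i) ↓ m * ((- 1#) ^ (n ∸ toℕ i) * x ^ (n ∸ toℕ i)))))
          ≡⟨ *-distribˡ-sum {suc n} x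
            (λ i → ι (n C toℕ i) * (ι (toℕ i) ↓ m * ((- 1#) ^ (n ∸ toℕ i) * x ^ (n ∸ toℕ i)))) ⟨
        x * ∑[ i ≤ n ] (ι (n C toℕ i) * (ι (toℕ i) ↓ m * ((- 1#) ^ (n ∸ toℕ i) * x ^ (n ∸ toℕ i))))
          ≡⟨ cong (x *_)
            (sum-cong-≗ {suc n} (λ i → cong (λ u → ι (n C toℕ i) * (ι (toℕ i) ↓ m * u))
            (sym ([-x]^n≡[-1]^n*x^n x (n ∸ toℕ i))))) ⟩
        x * ∑[ i ≤ n ] (ι (n C toℕ i) * (ι (toℕ i) ↓ m * (- x) ^ (n ∸ toℕ i)))
          ≡⟨ cong (x *_) (binomial-↓ m n (- x)) ⟩
        x * (ι n ↓ m * (1# - x) ^ (n ∸ m))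
          ≡⟨ solve 3 (λ x y z → x :* (y :* z) := y :* (x :* z)) refl x (ι n ↓ m) ((1# - x) ^ (n ∸ m)) ⟩
        ι n ↓ m * (x * (1# - x) ^ (n ∸ m)) ∎

  -- Nodal polynomials in the falling factorial basis

  -- Newton's nodal polynomial for the equally spaced nodes `0, α, …, (d - 1) α`.
  nodal : F → ℕ → F → F
  nodal α zero    x = 1#
  nodal α (suc d) x = nodal α d x * (x - α * ι d)

  nodal-zero : ∀ α {d} j → j < d → nodal α d (α * ι j) ≡ 0#
  nodal-zero α {suc d} j (s≤s j≤d) with ℕ.m≤n⇒m<n∨m≡n j≤d
  ... | inj₁ j<d  = trans (cong (_* (α * ι j - α * ι d)) (nodal-zero α j j<d)) (zeroˡ _)
  ... | inj₂ refl = trans (cong (nodal α d (α * ι j) *_) (-‿inverseʳ _)) (zeroʳ _)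

  -- The value of a linear functional at nodal α d x * x ↓ m, given its values f m at x ↓ m.
  transfer : F → (ℕ → F) → ℕ → ℕ → F
  transfer α f zero    m = f m
  transfer α f (suc d) m = transfer α f d (suc m) + (ι m - α * ι d) * transfer α f d m

  module Transfer (n : ℕ) (f : ℕ → F) (f-low : ∀ j → 1 ≤ j → j < n → f j ≡ 0#) where

    T : ℕ → ℕ → F
    T = transfer (ι (suc n)) f

    -- `T d m` combines only `f m, …, f (m + d)`. The value `f 0` is not assumed to vanish; in the
    -- recursion it appears only at `d = m = 0`, with coefficient `0 - a * 0`. For this reason
    -- `T-low′` keeps the coefficient while `T-low` excludes that case.
    T-low  : ∀ d m → 1 ≤ d ℕ.+ m → d ℕ.+ m < n → T d m ≡ 0#
    T-low′ : ∀ d m → d ℕ.+ m < n → (ι m - ι (suc n) * ι d) * T d m ≡ 0#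

    T-low zero    m 1≤ <n = f-low m 1≤ <n
    T-low (suc d) m 1≤ <n = begin
      T d (suc m) + (ι m - ι (suc n) * ι d) * T d m
        ≡⟨ cong₂ _+_ (T-low d (suc m) (subst (1 ≤_) (sym (ℕ.+-suc d m)) (s≤s z≤n))
          (subst (_< n) (sym (ℕ.+-suc d m)) <n))
                     (T-low′ d m (ℕ.<-trans (ℕ.n<1+n _) <n)) ⟩
      0# + 0#  ≡⟨ +-identityˡ 0# ⟩
      0#       ∎

    T-low′ zero zero <n = solve 2 (λ a y → (nat 0 :- a :* nat 0) :* y := nat 0) refl (ι (suc n)) (f 0)
    T-low′ zero (suc m) <n = trans
      (cong ((ι (suc m) - ι (suc n) * 0#) *_) (T-low zero (suc m) (s≤s z≤n) <n)) (zeroʳ _)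
    T-low′ (suc d) m <n = trans (cong ((ι m - ι (suc n) * ι (suc d)) *_) (T-low (suc d) m (s≤s z≤n) <n))
      (zeroʳ _)

    -- The polynomial is monic of degree `d + m = n`, so its top coefficient 1 is all that survives
    -- `f-low`.
    T-n : ∀ d m → d ℕ.+ m ≡ n → T d m ≡ f n
    T-n zero    m refl = refl
    T-n (suc d) m eq = begin
      T d (suc m) + (ι m - ι (suc n) * ι d) * T d m
        ≡⟨ cong₂ _+_ (T-n d (suc m) (trans (ℕ.+-suc d m) eq)) (T-low′ d m (ℕ.≤-reflexive eq)) ⟩
      f n + 0#  ≡⟨ +-identityʳ (f n) ⟩
      f n       ∎

    -- The factors 2 and 24 clear the denominators of the subleading coefficients of nodal.
    T-1+n : ∀ d m → d ℕ.+ m ≡ suc n →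
      ⟦ pos 2 ⟧ * T d m ≡
        ⟦ pos 2 ⟧ * f (1 ℕ.+ n) + (⟦ pos 2 ⟧ * (ι d * ι m) - ι n * (ι d * (ι d - 1#))) * f n
    T-1+n zero m refl =
      solve 4 (λ x y μ ν → nat 2 :* x := nat 2 :* x :+
        (nat 2 :* (nat 0 :* μ) :- ν :* (nat 0 :* (nat 0 :- nat 1))) :* y)
        refl (f (suc n)) (f n) (ι m) (ι n)
    T-1+n (suc d) m eq = begin
      ⟦ pos 2 ⟧ * (T d (suc m) + (ι m - ι (suc n) * ι d) * T d m)
        ≡⟨ cong (λ u → ⟦ pos 2 ⟧ * (T d (suc m) + (ι m - ι (suc n) * ι d) * u))
          (T-n d m (ℕ.suc-injective eq)) ⟩
      ⟦ pos 2 ⟧ * (T d (suc m) + (ι m - ι (suc n) * ι d) * f n)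
        ≡⟨ distribˡ _ _ _ ⟩
      ⟦ pos 2 ⟧ * T d (suc m) + ⟦ pos 2 ⟧ * ((ι m - ι (suc n) * ι d) * f n)
        ≡⟨ cong (_+ ⟦ pos 2 ⟧ * ((ι m - ι (suc n) * ι d) * f n))
          (T-1+n d (suc m) (trans (ℕ.+-suc d m) eq)) ⟩
      _ ≡⟨ solve 5 (λ x y δ μ ν →
             nat 2 :* x :+ (nat 2 :* (δ :* (nat 1 :+ μ)) :- ν :* (δ :* (δ :- nat 1))) :* y :+ nat 2 :*
               ((μ :- (nat 1 :+ ν) :* δ) :* y)
             := nat 2 :* x :+ (nat 2 :* ((nat 1 :+ δ) :* μ) :- ν :* ((nat 1 :+ δ) :* (nat 1 :+ δ :- nat 1)))
               :* y)
             refl (f (suc n)) (f n) (ι d) (ι m) (ι n) ⟩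
      _ ∎

    T-2+n : ∀ d m → d ℕ.+ m ≡ 2 ℕ.+ n →
      ⟦ pos 24 ⟧ * T d m ≡
        ⟦ pos 24 ⟧ * f (2 ℕ.+ n)
        + ⟦ pos 12 ⟧ * (⟦ pos 2 ⟧ * (ι d * ι m) - ι n * (ι d * (ι d - 1#))) * f (1 ℕ.+ n)
        + ι d * (ι d - 1#)
          * (⟦ pos 12 ⟧ * (ι m * (ι m - 1#)) - ⟦ pos 12 ⟧ * (ι n * ι m)
             - (⟦ pos 12 ⟧ * (ι n * ι m) - ⟦ pos 4 ⟧ * ι n) * (ι d - ⟦ pos 2 ⟧)
             + ι n * ι n * ((ι d - ⟦ pos 2 ⟧) * (⟦ pos 3 ⟧ * ι d - 1#)))
          * f n
    T-2+n zero m refl =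
      solve 5 (λ x y z μ ν → nat 24 :* x :=
        nat 24 :* x
        :+ nat 12 :* (nat 2 :* (nat 0 :* μ) :- ν :* (nat 0 :* (nat 0 :- nat 1))) :* y
        :+ nat 0 :* (nat 0 :- nat 1)
           :* (nat 12 :* (μ :* (μ :- nat 1)) :- nat 12 :* (ν :* μ)
               :- (nat 12 :* (ν :* μ) :- nat 4 :* ν) :* (nat 0 :- nat 2)
               :+ ν :* ν :* ((nat 0 :- nat 2) :* (nat 3 :* nat 0 :- nat 1)))
           :* z)
        refl (f (2 ℕ.+ n)) (f (suc n)) (f n) (ι m) (ι n)
    T-2+n (suc d) m eq = begin
      ⟦ pos 24 ⟧ * (T d (suc m) + κ * T d m)
        -- Splitting 24 as 12 times 2 brings the second summand to the form that `T-1+n` evaluates.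
        ≡⟨ solve 3 (λ x y κ → nat 24 :* (x :+ κ :* y) := nat 24 :* x :+ nat 12 :* (κ :* (nat 2 :* y))) refl
          (T d (suc m)) (T d m) κ ⟩
      ⟦ pos 24 ⟧ * T d (suc m) + ⟦ pos 12 ⟧ * (κ * (⟦ pos 2 ⟧ * T d m))
        ≡⟨ cong₂ (λ u v → u + ⟦ pos 12 ⟧ * (κ * v)) (T-2+n d (suc m) (trans (ℕ.+-suc d m) eq))
          (T-1+n d m (ℕ.suc-injective eq)) ⟩
      _ ≡⟨ solve 6 (λ x y z δ μ ν →
             nat 24 :* x
             :+ nat 12 :* (nat 2 :* (δ :* (nat 1 :+ μ)) :- ν :* (δ :* (δ :- nat 1))) :* y
             :+ δ :* (δ :- nat 1)
                :* (nat 12 :* ((nat 1 :+ μ) :* ((nat 1 :+ μ) :- nat 1)) :- nat 12 :* (ν :* (nat 1 :+ μ))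
                    :- (nat 12 :* (ν :* (nat 1 :+ μ)) :- nat 4 :* ν) :* (δ :- nat 2)
                    :+ ν :* ν :* ((δ :- nat 2) :* (nat 3 :* δ :- nat 1)))
                :* z
             :+ nat 12 :*
               ((μ :- (nat 1 :+ ν) :* δ) :* (nat 2 :* y :+ (nat 2 :* (δ :* μ) :- ν :* (δ :* (δ :- nat 1)))
               :* z))
             :=
             nat 24 :* x
             :+ nat 12 :* (nat 2 :* ((nat 1 :+ δ) :* μ) :- ν :* ((nat 1 :+ δ) :* ((nat 1 :+ δ) :- nat 1)))
               :* y
             :+ (nat 1 :+ δ) :* ((nat 1 :+ δ) :- nat 1)
                :* (nat 12 :* (μ :* (μ :- nat 1)) :- nat 12 :* (ν :* μ)
                    :- (nat 12 :* (ν :* μ) :- nat 4 :* ν) :* ((nat 1 :+ δ) :- nat 2)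
                    :+ ν :* ν :* (((nat 1 :+ δ) :- nat 2) :* (nat 3 :* (nat 1 :+ δ) :- nat 1)))
                :* z)
             refl (f (2 ℕ.+ n)) (f (suc n)) (f n) (ι d) (ι m) (ι n) ⟩
      _ ∎
      where κ = ι m - ι (suc n) * ι d

  -- Relations between the values of `S`

  module Exclusion {N : ℕ} (w b : Fin N → F) where

    open PowerSums w b

    -- Induction on `d` by `(x - α d) x↓m = x↓(m + 1) + (m - α d)
    -- x↓m`, the identity behind `transfer`. The application has `m =
    -- 0`; the induction needs every `m`.
    Λ-nodal : ∀ n α d m →
      Λ n (λ i → nodal α d (ι i) * ι i ↓ m) ≡ transfer α (λ j → Λ n (λ i → ι i ↓ j)) d m
    Λ-nodal n α zero    m = Λ-cong n {e′ = λ i → ι i ↓ m} (λ i → *-identityˡ (ι i ↓ m))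
    Λ-nodal n α (suc d) m = begin
      Λ n (λ i → nodal α d (ι i) * (ι i - α * ι d) * ι i ↓ m)
        ≡⟨ Λ-cong n step ⟩
      Λ n (λ i → nodal α d (ι i) * ι i ↓ suc m + (ι m - α * ι d) * (nodal α d (ι i) * ι i ↓ m))
        ≡⟨ Λ-+* n (λ i → nodal α d (ι i) * ι i ↓ suc m) (ι m - α * ι d) (λ i → nodal α d (ι i) * ι i ↓ m) ⟩
      Λ n (λ i → nodal α d (ι i) * ι i ↓ suc m) + (ι m - α * ι d) * Λ n (λ i → nodal α d (ι i) * ι i ↓ m)
        ≡⟨ cong₂ (λ u v → u + (ι m - α * ι d) * v) (Λ-nodal n α d (suc m)) (Λ-nodal n α d m) ⟩
      transfer α (λ j → Λ n (λ i → ι i ↓ j)) (suc d) m ∎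
      where
      step : ∀ i → nodal α d (ι i) * (ι i - α * ι d) * ι i ↓ m
                 ≡ nodal α d (ι i) * ι i ↓ suc m + (ι m - α * ι d) * (nodal α d (ι i) * ι i ↓ m)
      step i = trans
        (solve 5 (λ q x e p μ → q :* (x :- e) :* p := q :* (p :* (x :- μ)) :+ (μ :- e) :* (q :* p))
          refl (nodal α d (ι i)) (ι i) (α * ι d) (ι i ↓ m) (ι m))
        (cong (λ u → nodal α d (ι i) * u + (ι m - α * ι d) * (nodal α d (ι i) * ι i ↓ m))
          (sym (↓-suc (ι i) m)))

    -- The sum is the expansion of `b^a = (1 - (1 - b))^a` in powers of `1 - b`, and `w-order`
    -- replaces `b^a` by 1 under the weight.
    S-recurrence : ∀ a → (∀ i → w i * b i ^ a ≡ w i) → ∀ j →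
      ∑[ i ≤ a ] (ι (a C toℕ i) * (- 1#) ^ toℕ i * S (toℕ i ℕ.+ j)) ≡ S j
    S-recurrence a w-order j = begin
      ∑[ i ≤ a ] (c i * S (toℕ i ℕ.+ j))
        ≡⟨ L-∑ c (λ i x → x * (1# - x) ^ (toℕ i ℕ.+ j)) ⟨
      L (λ x → ∑[ i ≤ a ] (c i * (x * (1# - x) ^ (toℕ i ℕ.+ j))))
        ≡⟨ L-cong collapse ⟩
      ∑[ i < N ] (w i * (b i * (1# - b i) ^ j * b i ^ a))
        ≡⟨ sum-cong-≗ (λ i → trans
             (solve 4 (λ w x y z → w :* (x :* y :* z) := (w :* z) :* (x :* y)) refl (w i) (b i)
               ((1# - b i) ^ j) (b i ^ a))
             (cong (_* (b i * (1# - b i) ^ j)) (w-order i))) ⟩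
      S j ∎
      where
      c : Fin (suc a) → F
      c i = ι (a C toℕ i) * (- 1#) ^ toℕ i
      collapse : ∀ x → ∑[ i ≤ a ] (c i * (x * (1# - x) ^ (toℕ i ℕ.+ j))) ≡ x * (1# - x) ^ j * x ^ a
      collapse x = begin
        ∑[ i ≤ a ] (c i * (x * (1# - x) ^ (toℕ i ℕ.+ j)))
          ≡⟨ sum-cong-≗ {suc a} (λ i → term (toℕ i)) ⟩
        ∑[ i ≤ a ] (x * (1# - x) ^ j * (ι (a C toℕ i) * ((- (1# - x)) ^ toℕ i * 1# ^ (a ∸ toℕ i))))
          ≡⟨ *-distribˡ-sum {suc a} (x * (1# - x) ^ j)
            (λ i → ι (a C toℕ i) * ((- (1# - x)) ^ toℕ i * 1# ^ (a ∸ toℕ i))) ⟨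
        x * (1# - x) ^ j * ∑[ i ≤ a ] (ι (a C toℕ i) * ((- (1# - x)) ^ toℕ i * 1# ^ (a ∸ toℕ i)))
          ≡⟨ cong (x * (1# - x) ^ j *_) (binomial a (- (1# - x)) 1#) ⟩
        x * (1# - x) ^ j * (- (1# - x) + 1#) ^ a
          ≡⟨ cong (λ u → x * (1# - x) ^ j * u ^ a) (solve 1 (λ x → :- (nat 1 :- x) :+ nat 1 := x) refl x) ⟩
        x * (1# - x) ^ j * x ^ a ∎
        where
        term : ∀ i → ι (a C i) * (- 1#) ^ i * (x * (1# - x) ^ (i ℕ.+ j))
                   ≡ x * (1# - x) ^ j * (ι (a C i) * ((- (1# - x)) ^ i * 1# ^ (a ∸ i)))
        term i = begin
          ι (a C i) * (- 1#) ^ i * (x * (1# - x) ^ (i ℕ.+ j))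
            ≡⟨ cong (λ u → ι (a C i) * (- 1#) ^ i * (x * u)) (^-homo-* (1# - x) i j) ⟩
          ι (a C i) * (- 1#) ^ i * (x * ((1# - x) ^ i * (1# - x) ^ j))
            ≡⟨ solve 5 (λ c s x y z → c :* s :* (x :* (z :* y)) := x :* y :* (c :* (s :* z :* nat 1)))
                 refl (ι (a C i)) ((- 1#) ^ i) x ((1# - x) ^ j) ((1# - x) ^ i) ⟩
          x * (1# - x) ^ j * (ι (a C i) * ((- 1#) ^ i * (1# - x) ^ i * 1#))
            ≡⟨ cong₂ (λ u v → x * (1# - x) ^ j * (ι (a C i) * (u * v))) ([-x]^n≡[-1]^n*x^n (1# - x) i)
              (1^n≡1 (a ∸ i)) ⟨
          x * (1# - x) ^ j * (ι (a C i) * ((- (1# - x)) ^ i * 1# ^ (a ∸ i))) ∎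

    -- In `S-recurrence` the term at index 0 is `S j` and cancels the right-hand side. From index 4
    -- on the terms fall into the range covered by `high`, which leaves indices 1, 2 and 3.
    S-recurrence₃ : ∀ n → 3 ≤ n → (∀ i → w i * b i ^ suc n ≡ w i) →
      ∀ j → (∀ i → 1 ≤ i → i < n → S (3 ℕ.+ j ℕ.+ i) ≡ 0#) →
      ι (suc n) * S (1 ℕ.+ j) ≡ ι (suc n C 2) * S (2 ℕ.+ j) - ι (suc n C 3) * S (3 ℕ.+ j)
    S-recurrence₃ (suc (suc (suc n))) _ w-order j high = x∙y⁻¹≈ε⇒x≈y _ _ (begin
      ι a * x₁ - (c₂ * x₂ - c₃ * x₃)
        ≡⟨ solve 7 (λ a c₂ c₃ x₀ x₁ x₂ x₃ → a :* x₁ :- (c₂ :* x₂ :- c₃ :* x₃)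
             := x₀ :- ((nat 1 :+ nat 0) :* nat 1 :* x₀
                       :+ (a :* (:- nat 1 :* nat 1) :* x₁
                       :+ (c₂ :* (:- nat 1 :* (:- nat 1 :* nat 1)) :* x₂
                       :+ (c₃ :* (:- nat 1 :* (:- nat 1 :* (:- nat 1 :* nat 1))) :* x₃ :+ nat 0)))))
             refl (ι a) c₂ c₃ (S j) x₁ x₂ x₃ ⟩
      S j - (t 0 + (ι a * (- 1#) ^ 1 * x₁ + (t 2 + (t 3 + 0#))))
        ≡⟨ cong₂ (λ u v → S j - (t 0 + (ι u * (- 1#) ^ 1 * x₁ + (t 2 + (t 3 + v))))) (nC1≡n a) rest ⟨
      S j - ∑[ i ≤ a ] t (toℕ i)
        ≡⟨ cong (λ u → S j - u) (S-recurrence a w-order j) ⟩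
      S j - S j
        ≡⟨ -‿inverseʳ (S j) ⟩
      0# ∎)
      where
      a = 4 ℕ.+ n
      c₂ = ι (a C 2)
      c₃ = ι (a C 3)
      x₁ = S (1 ℕ.+ j)
      x₂ = S (2 ℕ.+ j)
      x₃ = S (3 ℕ.+ j)
      t : ℕ → F
      t i = ι (a C i) * (- 1#) ^ i * S (i ℕ.+ j)
      rest : ∑[ i ≤ n ] t (4 ℕ.+ toℕ i) ≡ 0#
      rest = sum-zero {suc n} _ λ i → trans
        (cong (ι (a C (4 ℕ.+ toℕ i)) * (- 1#) ^ (4 ℕ.+ toℕ i) *_) (trans
          (cong S (solveℕ 2 (λ i j → conℕ 4 :+ℕ i :+ℕ j :=ℕ conℕ 3 :+ℕ j :+ℕ (conℕ 1 :+ℕ i)) refl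
            (toℕ i) j))
          (high (suc (toℕ i)) (s≤s z≤n) (s≤s (ℕ.m≤n⇒m≤1+n (toℕ<n i))))))
        (zeroʳ _)
    S-recurrence₃ (suc zero) (s≤s ()) _ _ _
    S-recurrence₃ (suc (suc zero)) (s≤s (s≤s ())) _ _ _

    -- Elimination of the cases `k < n` and `k = n`

    module Parameters
      (integral : ∀ {x y} → x * y ≡ 0# → x ≡ 0# ⊎ y ≡ 0#)
      (n k : ℕ)
      (ι≢0 : ∀ j → 1 ≤ j → j ≤ suc n ℕ.* k ℕ.+ n → ι j ≢ 0#)
      (P-vanishes : ∀ j → ¬ suc n ∣ j → P j ≡ 0#)
      (w-order : ∀ i → w i * b i ^ suc n ≡ w i)
      (θ : F) (S-shift : ∀ j → 1 ≤ j → S (suc n ℕ.* k ℕ.+ j) ≡ θ * S j)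
      (S-g≢0 : S (suc n ℕ.* k) ≢ 0#)
      where

      open IntegralDomain integral

      a g M : ℕ
      a = suc n
      g = a ℕ.* k
      M = g ℕ.+ n

      -- The reason for the choice of `M`: the coefficient of `X^i` carries the power sum of index
      -- `M + 1 - i`, so with `a` dividing `M + 1` it can be nonzero only if `a` divides `i`. The
      -- multiples of `a` up to `M` are then `0, a, …, k a`.
      1+M≡[1+k]*a : suc M ≡ suc k ℕ.* a
      1+M≡[1+k]*a = solveℕ 2 (λ n k →
        conℕ 1 :+ℕ ((conℕ 1 :+ℕ n) :*ℕ k :+ℕ n) :=ℕ (conℕ 1 :+ℕ k) :*ℕ (conℕ 1 :+ℕ n)) refl n k

      f : ℕ → F
      f m = Λ M (λ i → ι i ↓ m)

      -- Expanding `(1 - b)^j` produces power sums of indices 1 to `j + 1`, and `j + 1 ≤ n < a`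
      -- rules out multiples of `a`.
      S-low : ∀ j → j < n → S j ≡ 0#
      S-low j j<n = begin
        S j                 ≡⟨ *-identityˡ (S j) ⟨
        1# * S j            ≡⟨ Λ-↓ j 0 ⟨
        Λ j (λ i → 1#)      ≡⟨ Λ-vanishes j (λ i → 1#) (λ i i≤j → inj₂ (P-vanishes (suc (j ∸ i)) (λ a∣ →
                                 ℕ.<⇒≱ j<n (ℕ.≤-trans (ℕ.≤-pred (∣⇒≤ a∣)) (ℕ.m∸n≤m j i))))) ⟩
        0#                  ∎

      S-high : ∀ j → 1 ≤ j → j < n → S (g ℕ.+ j) ≡ 0#
      S-high j 1≤j j<n = trans (S-shift j 1≤j) (trans (cong (θ *_) (S-low j j<n)) (zeroʳ θ))

      f-low : ∀ j → 1 ≤ j → j < n → f j ≡ 0#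
      f-low j 1≤j j<n = begin
        f j                              ≡⟨ Λ-↓ M j ⟩
        ι M ↓ j * S (g ℕ.+ n ∸ j)        ≡⟨ cong (λ u → ι M ↓ j * S u) (ℕ.+-∸-assoc g (ℕ.<⇒≤ j<n)) ⟩
        ι M ↓ j * S (g ℕ.+ (n ∸ j))
          ≡⟨ cong (ι M ↓ j *_) (S-high (n ∸ j) (ℕ.m<n⇒0<n∸m j<n) (ℕ.∸-monoʳ-< 1≤j (ℕ.<⇒≤ j<n))) ⟩
        ι M ↓ j * 0#                     ≡⟨ zeroʳ _ ⟩
        0#                               ∎

      open Transfer n f f-low

      -- The factors are the images of `g + m, …, g + 1`.
      ↓-≢0 : ∀ m → (∀ j → 1 ≤ j → j ≤ g ℕ.+ m → ι j ≢ 0#) → 1# ≢ 0# → ι (g ℕ.+ m) ↓ m ≢ 0#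
      ↓-≢0 zero    nz 1≢0 = 1≢0
      ↓-≢0 (suc m) nz 1≢0 rewrite ℕ.+-suc g m = *-≢0 (nz (suc (g ℕ.+ m)) (s≤s z≤n) ℕ.≤-refl)
        (subst (λ u → u ↓ m ≢ 0#) (sym (ι-suc-1 (g ℕ.+ m)))
          (↓-≢0 m (λ j 1≤j j≤ → nz j 1≤j (ℕ.m≤n⇒m≤1+n j≤)) 1≢0))

      -- For d > k the nodes of nodal (ι a) d include every multiple of a up to M.
      T-vanishes : ∀ d → k < d → T d 0 ≡ 0#
      T-vanishes d k<d = trans (sym (Λ-nodal M (ι a) d 0))
        (Λ-vanishes M (λ i → nodal (ι a) d (ι i) * 1#) vanish)
        where
        vanish : ∀ i → i ≤ M → nodal (ι a) d (ι i) * 1# ≡ 0# ⊎ P (suc (M ∸ i)) ≡ 0#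
        vanish i i≤M with a ∣? i
        ... | yes (divides q refl) = inj₁ (trans (*-identityʳ _) (begin
            nodal (ι a) d (ι (q ℕ.* a))   ≡⟨ cong (λ u → nodal (ι a) d (ι u)) (ℕ.*-comm q a) ⟩
            nodal (ι a) d (ι (a ℕ.* q))   ≡⟨ cong (nodal (ι a) d) (×1-homo-* a q) ⟩
            nodal (ι a) d (ι a * ι q)     ≡⟨ nodal-zero (ι a) q (ℕ.<-≤-trans q<1+k k<d) ⟩
            0#                            ∎))
          where
          q<1+k : q < suc k
          q<1+k = ℕ.*-cancelʳ-< a q (suc k) (ℕ.≤-<-trans i≤M (ℕ.≤-reflexive 1+M≡[1+k]*a))
        ... | no a∤i = inj₂
          (P-vanishes (suc (M ∸ i)) λ a∣ → a∤i
          (∣m+n∣m⇒∣n (subst (a ∣_) 1+M≡ (divides (suc k) 1+M≡[1+k]*a)) a∣))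
          where
          1+M≡ : suc M ≡ suc (M ∸ i) ℕ.+ i
          1+M≡ = cong suc (sym (ℕ.m∸n+n≡m i≤M))

      f-n : f n ≡ ι M ↓ n * S g
      f-n = trans (Λ-↓ M n) (cong (λ u → ι M ↓ n * S u) (ℕ.m+n∸n≡m g n))

      1≤k⇒1≤g : 1 ≤ k → 1 ≤ g
      1≤k⇒1≤g 1≤k = ℕ.*-mono-≤ {1} {a} (s≤s z≤n) 1≤k

      1≢0 : 1 ≤ k → 1# ≢ 0#
      1≢0 1≤k 1≡0 = ι≢0 1 (s≤s z≤n) (ℕ.≤-trans (1≤k⇒1≤g 1≤k) (ℕ.m≤m+n g n)) (trans (+-identityʳ 1#) 1≡0)

      u≢0 : 1 ≤ k → ι M ↓ n ≢ 0#
      u≢0 1≤k = ↓-≢0 n ι≢0 (1≢0 1≤k)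

      -- If `k < n`, then `d = n` nodes already cover all exponents, while the value is the leading
      -- term `f n`, a nonzero multiple of `S g`.
      k≮n : 1 ≤ k → ¬ k < n
      k≮n 1≤k k<n = *-≢0 (u≢0 1≤k) S-g≢0 (begin
        ι M ↓ n * S g    ≡⟨ f-n ⟨
        f n              ≡⟨ T-n n 0 (ℕ.+-identityʳ n) ⟨
        T n 0            ≡⟨ T-vanishes n k<n ⟩
        0#               ∎)

      f-+n : ∀ i → f (i ℕ.+ n) ≡ ι M ↓ (i ℕ.+ n) * S (g ∸ i)
      f-+n i = trans (Λ-↓ M (i ℕ.+ n)) (cong (λ u → ι M ↓ (i ℕ.+ n) * S u) (begin
        g ℕ.+ n ∸ (i ℕ.+ n)   ≡⟨ cong₂ _∸_ (ℕ.+-comm g n) (ℕ.+-comm i n) ⟩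
        n ℕ.+ g ∸ (n ℕ.+ i)   ≡⟨ ℕ.[m+n]∸[m+o]≡n∸o n g i ⟩
        g ∸ i                 ∎))

      -- For `k = n` the values at `d = n + 1` and `d = n + 2` vanish. The first gives `2x₁≡`, the
      -- recurrence then gives `12x₂≡`, and inserting both into the second, `top`, leaves `S g`
      -- times a product of nonzero factors.
      k≢n : 3 ≤ n → k ≢ n
      k≢n 3≤n k≡n = *-≢0 (*-≢0 (*-≢0 (*-≢0 (*-≢0 (u≢0 1≤k) ν≢0) ν≢0) (*-≢0 (*-≢0 ν+1≢0 ν+1≢0) ν+2≢0)) ν-2≢0)
        S-g≢0 final
        where
        1≤n : 1 ≤ n
        1≤n = ℕ.≤-trans (s≤s z≤n) 3≤n
        1≤k : 1 ≤ k
        1≤k = subst (1 ≤_) (sym k≡n) 1≤n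
        n≤g : n ≤ g
        n≤g = ℕ.≤-trans (ℕ.≤-reflexive (sym k≡n)) (ℕ.m≤m+n k (n ℕ.* k))
        3≤g : 3 ≤ g
        3≤g = ℕ.≤-trans 3≤n n≤g
        ν u s γ x₁ x₂ c₂ c₃ : F
        ν = ι n
        u = ι M ↓ n
        s = S g
        γ = ι g
        x₁ = S (g ∸ 1)
        x₂ = S (g ∸ 2)
        c₂ = ι (a C 2)
        c₃ = ι (a C 3)

        γ≡ : γ ≡ (1# + ν) * ν
        γ≡ = trans (×1-homo-* a k) (cong (λ t → ι a * ι t) k≡n)

        ν≢0 : ν ≢ 0#
        ν≢0 = ι≢0 n 1≤n (ℕ.m≤n+m n g)
        ν+1≢0 : 1# + ν ≢ 0#
        ν+1≢0 = ι≢0 a (s≤s z≤n) (ℕ.+-monoˡ-≤ n (ℕ.≤-trans (s≤s z≤n) 3≤g))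
        ν+2≢0 : 1# + (1# + ν) ≢ 0#
        ν+2≢0 = ι≢0 (suc a) (s≤s z≤n) (ℕ.+-monoˡ-≤ n (ℕ.≤-trans (s≤s (s≤s z≤n)) 3≤g))
        -- `n ≥ 3` makes `n - 2` positive. For `n = 2` the factor is 0, in accordance with the cube
        -- roots of unity, whose six nonzero differences form a coset of the sixth roots of unity.
        ν-2≢0 : ν - ι 2 ≢ 0#
        ν-2≢0 = subst (_≢ 0#) (begin
            ι (n ∸ 2)                ≡⟨ solve 2 (λ x y → x := y :+ x :- y) refl (ι (n ∸ 2)) (ι 2) ⟩
            ι 2 + ι (n ∸ 2) - ι 2    ≡⟨ cong (_- ι 2) (×-homo-+ 1# 2 (n ∸ 2)) ⟨
            ι (2 ℕ.+ (n ∸ 2)) - ι 2  ≡⟨ cong (λ t → ι t - ι 2) (ℕ.m+[n∸m]≡n (ℕ.≤-trans (ℕ.n≤1+n 2) 3≤n)) ⟩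
            ν - ι 2                  ∎)
          (ι≢0 (n ∸ 2) (ℕ.m<n⇒0<n∸m 3≤n) (ℕ.≤-trans (ℕ.m∸n≤m n 2) (ℕ.m≤n+m n g)))

        f-1+n : f (1 ℕ.+ n) ≡ u * γ * x₁
        f-1+n = trans (f-+n 1) (cong (_* x₁) (trans (↓-suc (ι M) n) (cong (u *_) (begin
          ι M - ν          ≡⟨ cong (_- ν) (×-homo-+ 1# g n) ⟩
          γ + ν - ν        ≡⟨ solve 2 (λ x y → x :+ y :- y := x) refl γ ν ⟩
          γ                ∎))))

        f-2+n : f (2 ℕ.+ n) ≡ u * γ * (γ - 1#) * x₂
        f-2+n = trans (f-+n 2) (cong (_* x₂) (begin
          ι M ↓ (2 ℕ.+ n)                    ≡⟨ ↓-suc (ι M) (suc n) ⟩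
          ι M ↓ suc n * (ι M - ι a)          ≡⟨ cong (_* (ι M - ι a)) (↓-suc (ι M) n) ⟩
          u * (ι M - ν) * (ι M - ι a)        ≡⟨ cong (λ t → u * (t - ν) * (t - ι a)) (×-homo-+ 1# g n) ⟩
          u * (γ + ν - ν) * (γ + ν - ι a)
            ≡⟨ solve 3 (λ u x y → u :* (x :+ y :- y) :* (x :+ y :- (nat 1 :+ y)) := u :* x :* (x :- nat 1))
              refl u γ ν ⟩
          u * γ * (γ - 1#)                   ∎))

        2x₁≡ : ⟦ pos 2 ⟧ * x₁ ≡ ν * s
        -- The cancelled factor is `u * γ`, the coefficient of `x₁` in `f (1 + n)`, written through
        -- `γ≡`.
        2x₁≡ = x∙y⁻¹≈ε⇒x≈y _ _ (cancelˡ (*-≢0 (*-≢0 (u≢0 1≤k) ν+1≢0) ν≢0) (begin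
          u * (1# + ν) * ν * (⟦ pos 2 ⟧ * x₁ - ν * s)
            ≡⟨ solve 4 (λ u ν x s → u :* (nat 1 :+ ν) :* ν :* (nat 2 :* x :- ν :* s)
                 := nat 2 :* (u :* ((nat 1 :+ ν) :* ν) :* x)
                    :+ (nat 2 :* ((nat 1 :+ ν) :* nat 0) :- ν :* ((nat 1 :+ ν) :* (nat 1 :+ ν :- nat 1))) :*
                      (u :* s))
                 refl u ν x₁ s ⟩
          ⟦ pos 2 ⟧ * (u * ((1# + ν) * ν) * x₁) + (⟦ pos 2 ⟧ * (ι a * 0#) - ν * (ι a * (ι a - 1#))) *
            (u * s)
            ≡⟨ cong₂ (λ p q → ⟦ pos 2 ⟧ * p + (⟦ pos 2 ⟧ * (ι a * 0#) - ν * (ι a * (ι a - 1#))) * q)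
                 (trans f-1+n (cong (λ t → u * t * x₁) γ≡)) f-n ⟨
          ⟦ pos 2 ⟧ * f (1 ℕ.+ n) + (⟦ pos 2 ⟧ * (ι a * 0#) - ν * (ι a * (ι a - 1#))) * f n
            ≡⟨ T-1+n a 0 (ℕ.+-identityʳ a) ⟨
          ⟦ pos 2 ⟧ * T a 0
            ≡⟨ cong (⟦ pos 2 ⟧ *_) (T-vanishes a (s≤s (ℕ.≤-reflexive k≡n))) ⟩
          ⟦ pos 2 ⟧ * 0#
            ≡⟨ zeroʳ _ ⟩
          0# ∎))

        g≡ : 3 ℕ.+ (g ∸ 3) ≡ g
        g≡ = ℕ.m+[n∸m]≡n 3≤g

        -- Taken at `j = g - 3`, so that the surviving values are those at `g - 2`, `g - 1` and `g`,
        -- and the vanishing ones are `S (g + i)` with `0 < i < n`.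
        recurrence : ι a * x₂ ≡ c₂ * x₁ - c₃ * s
        recurrence = begin
          ι a * S (g ∸ 2)
            ≡⟨ cong (λ t → ι a * S (t ∸ 2)) g≡ ⟨
          ι a * S (1 ℕ.+ (g ∸ 3))
            ≡⟨ S-recurrence₃ n 3≤n w-order (g ∸ 3)
                 (λ i 1≤i i<n → trans (cong (λ t → S (t ℕ.+ i)) g≡) (S-high i 1≤i i<n)) ⟩
          c₂ * S (2 ℕ.+ (g ∸ 3)) - c₃ * S (3 ℕ.+ (g ∸ 3))
            ≡⟨ cong (λ t → c₂ * S (t ∸ 1) - c₃ * S t) g≡ ⟩
          c₂ * x₁ - c₃ * s ∎

        12x₂≡ : ⟦ pos 12 ⟧ * x₂ ≡ ν * (ν + ⟦ pos 2 ⟧) * s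
        12x₂≡ = x∙y⁻¹≈ε⇒x≈y _ _ (cancelˡ ν+1≢0 (begin
          (1# + ν) * (⟦ pos 12 ⟧ * x₂ - ν * (ν + ⟦ pos 2 ⟧) * s)
            ≡⟨ solve 3 (λ ν x s → (nat 1 :+ ν) :* (nat 12 :* x :- ν :* (ν :+ nat 2) :* s)
                 := nat 12 :* ((nat 1 :+ ν) :* x) :- (nat 1 :+ ν) :* (ν :* (ν :+ nat 2) :* s)) refl ν x₂ s ⟩
          ⟦ pos 12 ⟧ * (ι a * x₂) - ι a * (ν * (ν + ⟦ pos 2 ⟧) * s)
            ≡⟨ cong (λ t → ⟦ pos 12 ⟧ * t - ι a * (ν * (ν + ⟦ pos 2 ⟧) * s)) recurrence ⟩
          ⟦ pos 12 ⟧ * (c₂ * x₁ - c₃ * s) - ι a * (ν * (ν + ⟦ pos 2 ⟧) * s)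
            -- 12 is spent as 3 · 2 · 2 on `c₂ * x₁`, for `ιC₂` and `2x₁≡`, and as 2 · 6 on `c₃`,
            -- for `ιC₃`.
            ≡⟨ solve 5 (λ ν c₂ c₃ x s →
                 nat 12 :* (c₂ :* x :- c₃ :* s) :- (nat 1 :+ ν) :* (ν :* (ν :+ nat 2) :* s)
                 := nat 3 :* ((c₂ :* (nat 1 :+ (nat 1 :+ nat 0))) :* (nat 2 :* x))
                    :- nat 2 :* (c₃ :* (nat 1 :+ (nat 1 :+ (nat 1 :+ nat 0))) :* (nat 1 :+ (nat 1 :+ nat 0))
                      :* s)
                    :- (nat 1 :+ ν) :* (ν :* (ν :+ nat 2) :* s))
                 refl ν c₂ c₃ x₁ s ⟩
          ⟦ pos 3 ⟧ * ((c₂ * ι 2) * (⟦ pos 2 ⟧ * x₁)) - ⟦ pos 2 ⟧ * (c₃ * ι 3 * ι 2 * s) - ι a *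
            (ν * (ν + ⟦ pos 2 ⟧) * s)
            ≡⟨ cong₂ (λ p q → p - ⟦ pos 2 ⟧ * (q * s) - ι a * (ν * (ν + ⟦ pos 2 ⟧) * s))
                 (cong₂ (λ p q → ⟦ pos 3 ⟧ * (p * q)) (ιC₂ n) 2x₁≡) (ιC₃ n) ⟩
          ⟦ pos 3 ⟧ * (ι a * ν * (ν * s)) - ⟦ pos 2 ⟧ * (ι a * (ν * (ν - 1#)) * s) - ι a *
            (ν * (ν + ⟦ pos 2 ⟧) * s)
            ≡⟨ solve 2 (λ ν s → nat 3 :* ((nat 1 :+ ν) :* ν :* (ν :* s)) :- nat 2 :*
              ((nat 1 :+ ν) :* (ν :* (ν :- nat 1)) :* s)
                 :- (nat 1 :+ ν) :* (ν :* (ν :+ nat 2) :* s) := nat 0) refl ν s ⟩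
          0# ∎))

        δ : F
        δ = ι (2 ℕ.+ n)

        G₁ G₀ : F
        G₁ = ⟦ pos 12 ⟧ * (⟦ pos 2 ⟧ * (δ * 0#) - ν * (δ * (δ - 1#)))
        G₀ = δ * (δ - 1#)
             * (⟦ pos 12 ⟧ * (0# * (0# - 1#)) - ⟦ pos 12 ⟧ * (ν * 0#)
                - (⟦ pos 12 ⟧ * (ν * 0#) - ⟦ pos 4 ⟧ * ν) * (δ - ⟦ pos 2 ⟧)
                + ν * ν * ((δ - ⟦ pos 2 ⟧) * (⟦ pos 3 ⟧ * δ - 1#)))

        top : ⟦ pos 24 ⟧ * (u * γ * (γ - 1#) * x₂) + G₁ * (u * γ * x₁) + G₀ * (u * s) ≡ 0#
        top = begin
          ⟦ pos 24 ⟧ * (u * γ * (γ - 1#) * x₂) + G₁ * (u * γ * x₁) + G₀ * (u * s)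
            ≡⟨ cong₂ (λ p q → ⟦ pos 24 ⟧ * p + G₁ * q + G₀ * (u * s)) f-2+n f-1+n ⟨
          ⟦ pos 24 ⟧ * f (2 ℕ.+ n) + G₁ * f (1 ℕ.+ n) + G₀ * (u * s)
            ≡⟨ cong (λ p → ⟦ pos 24 ⟧ * f (2 ℕ.+ n) + G₁ * f (1 ℕ.+ n) + G₀ * p) f-n ⟨
          ⟦ pos 24 ⟧ * f (2 ℕ.+ n) + G₁ * f (1 ℕ.+ n) + G₀ * f n
            ≡⟨ T-2+n (suc a) 0 (ℕ.+-identityʳ (suc a)) ⟨
          ⟦ pos 24 ⟧ * T (suc a) 0
            ≡⟨ cong (⟦ pos 24 ⟧ *_) (T-vanishes (suc a) (s≤s (ℕ.m≤n⇒m≤1+n (ℕ.≤-reflexive k≡n)))) ⟩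
          ⟦ pos 24 ⟧ * 0#
            ≡⟨ zeroʳ _ ⟩
          0# ∎

        final : u * ν * ν * ((1# + ν) * (1# + ν) * (1# + (1# + ν))) * (ν - ι 2) * s ≡ 0#
        final = begin
          u * ν * ν * ((1# + ν) * (1# + ν) * (1# + (1# + ν))) * (ν - ι 2) * s
            -- The eliminated form of `top`: after replacing `12 x₂`, `2 x₁` and `γ`, its left side
            -- is minus the product in the claim. The remaining steps undo these replacements.
            ≡⟨ solve 3 (λ u ν s →
                 u :* ν :* ν :* ((nat 1 :+ ν) :* (nat 1 :+ ν) :* (nat 1 :+ (nat 1 :+ ν))) :*
                   (ν :- (nat 1 :+ (nat 1 :+ nat 0))) :* s
                 := :- (nat 2 :* u :* ((nat 1 :+ ν) :* ν) :* ((nat 1 :+ ν) :* ν :- nat 1) :*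
                   (ν :* (ν :+ nat 2) :* s)
                    :+ nat 6 :* (nat 2 :* ((nat 1 :+ (nat 1 :+ ν)) :* nat 0) :- ν :*
                      ((nat 1 :+ (nat 1 :+ ν)) :* ((nat 1 :+ (nat 1 :+ ν)) :- nat 1)))
                       :* (u :* ((nat 1 :+ ν) :* ν) :* (ν :* s))
                    :+ (nat 1 :+ (nat 1 :+ ν)) :* ((nat 1 :+ (nat 1 :+ ν)) :- nat 1)
                       :* (nat 12 :* (nat 0 :* (nat 0 :- nat 1)) :- nat 12 :* (ν :* nat 0)
                           :- (nat 12 :* (ν :* nat 0) :- nat 4 :* ν) :* ((nat 1 :+ (nat 1 :+ ν)) :- nat 2)
                           :+ ν :* ν :*
                             (((nat 1 :+ (nat 1 :+ ν)) :- nat 2) :*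
                             (nat 3 :* (nat 1 :+ (nat 1 :+ ν)) :- nat 1)))
                       :* (u :* s)))
                 refl u ν s ⟩
          - (⟦ pos 2 ⟧ * u * ((1# + ν) * ν) * ((1# + ν) * ν - 1#) * (ν * (ν + ⟦ pos 2 ⟧) * s) + G₁′ *
            (u * ((1# + ν) * ν) * (ν * s)) + G₀ * (u * s))
            ≡⟨ cong₂ (λ p q → - (⟦ pos 2 ⟧ * u * ((1# + ν) * ν) * ((1# + ν) * ν - 1#) * p + G₁′ *
              (u * ((1# + ν) * ν) * q) + G₀ * (u * s))) 12x₂≡ 2x₁≡ ⟨
          - (⟦ pos 2 ⟧ * u * ((1# + ν) * ν) * ((1# + ν) * ν - 1#) * (⟦ pos 12 ⟧ * x₂) + G₁′ *
            (u * ((1# + ν) * ν) * (⟦ pos 2 ⟧ * x₁)) + G₀ * (u * s))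
            ≡⟨ cong (λ t → - (⟦ pos 2 ⟧ * u * t * (t - 1#) * (⟦ pos 12 ⟧ * x₂) + G₁′ *
              (u * t * (⟦ pos 2 ⟧ * x₁)) + G₀ * (u * s))) γ≡ ⟨
          - (⟦ pos 2 ⟧ * u * γ * (γ - 1#) * (⟦ pos 12 ⟧ * x₂) + G₁′ * (u * γ * (⟦ pos 2 ⟧ * x₁)) + G₀ *
            (u * s))
            ≡⟨ solve 6 (λ u γ x₁ x₂ z e →
                 :- (nat 2 :* u :* γ :* (γ :- nat 1) :* (nat 12 :* x₂) :+ nat 6 :* e :*
                   (u :* γ :* (nat 2 :* x₁)) :+ z)
                 := :- (nat 24 :* (u :* γ :* (γ :- nat 1) :* x₂) :+ nat 12 :* e :* (u :* γ :* x₁) :+ z))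
                 refl u γ x₁ x₂ (G₀ * (u * s)) (⟦ pos 2 ⟧ * (δ * 0#) - ν * (δ * (δ - 1#))) ⟩
          - (⟦ pos 24 ⟧ * (u * γ * (γ - 1#) * x₂) + G₁ * (u * γ * x₁) + G₀ * (u * s))
            ≡⟨ cong -_ top ⟩
          - 0#
            ≡⟨ solve 0 (:- nat 0 := nat 0) refl ⟩
          0# ∎
          where
          -- Half of `G₁`; the other factor 2 stays with `x₁` for `2x₁≡`.
          G₁′ : F
          G₁′ = ⟦ pos 6 ⟧ * (⟦ pos 2 ⟧ * (δ * 0#) - ν * (δ * (δ - 1#)))

-- Sums over subsets, and counting

module SubsetSum {c ℓ} (M : CommutativeMonoid c ℓ) where

  open CommutativeMonoid M renaming (refl to ≈-refl; sym to ≈-sym; trans to ≈-trans)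
  open import Algebra.Properties.CommutativeMonoid.Sum M
  open import Algebra.Properties.Monoid.Mult monoid using () renaming (_×_ to _·_)

  sum-supported-at : ∀ {n} (i : Fin n) (f : Fin n → Carrier) → (∀ j → j ≢ i → f j ≈ ε) → sum f ≈ f i
  sum-supported-at {suc n} zero f f≈ε = ≈-trans
    (∙-congˡ (≈-trans (sum-cong-≋ (λ j → f≈ε (suc j) λ ())) (sum-replicate-zero n)))
    (identityʳ _)
  sum-supported-at {suc n} (suc i) f f≈ε = ≈-trans
    (∙-cong (f≈ε zero λ ()) (sum-supported-at i (f ∘ suc) (λ j j≢i → f≈ε (suc j) λ { refl → j≢i refl })))
    (identityˡ _)

  -- Over a commutative monoid this serves both for cardinalities and, multiplicatively in
  -- `^-order`, for powers.
  sum-indicator : ∀ {n} (A : Subset n) x → ∑[ i < n ] (if lookup A i then x else ε) ≈ ∣ A ∣ · x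
  sum-indicator []          x = ≈-refl
  sum-indicator (true ∷ A)  x = ∙-congˡ (sum-indicator A x)
  sum-indicator (false ∷ A) x = ≈-trans (identityˡ _) (sum-indicator A x)

∣A∣≤1+∣A[x]≔outside∣ : ∀ {n} (A : Subset n) x → ∣ A ∣ ≤ suc ∣ A [ x ]≔ outside ∣
∣A∣≤1+∣A[x]≔outside∣ (true  ∷ A) zero    = ℕ.≤-refl
∣A∣≤1+∣A[x]≔outside∣ (false ∷ A) zero    = ℕ.n≤1+n _
∣A∣≤1+∣A[x]≔outside∣ (true  ∷ A) (suc x) = s≤s (∣A∣≤1+∣A[x]≔outside∣ A x)
∣A∣≤1+∣A[x]≔outside∣ (false ∷ A) (suc x) = ∣A∣≤1+∣A[x]≔outside∣ A x

[1+n]²≡[1+n]+c[1+n]k⇒k≤n : ∀ {n k c} → suc n ℕ.* suc n ≡ suc n ℕ.+ c ℕ.* (suc n ℕ.* k) → 1 ≤ c → k ≤ n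
[1+n]²≡[1+n]+c[1+n]k⇒k≤n {n} {k} {c} eq 1≤c = ℕ.≤-trans (ℕ.m≤n*m k c {{ℕ.>-nonZero 1≤c}}) (ℕ.≤-reflexive (sym n≡ck))
  where
  open ≡-Reasoning
  n≡ck : n ≡ c ℕ.* k
  n≡ck = ℕ.*-cancelˡ-≡ n (c ℕ.* k) (suc n) (ℕ.+-cancelˡ-≡ (suc n) _ _ (begin
    suc n ℕ.+ suc n ℕ.* n              ≡⟨ ℕ.*-suc (suc n) n ⟨
    suc n ℕ.* suc n                    ≡⟨ eq ⟩
    suc n ℕ.+ c ℕ.* (suc n ℕ.* k)
      ≡⟨ cong (suc n ℕ.+_)
        (solveℕ 3 (λ c n k → c :*ℕ ((conℕ 1 :+ℕ n) :*ℕ k) :=ℕ (conℕ 1 :+ℕ n) :*ℕ (c :*ℕ k)) refl c n k) ⟩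
    suc n ℕ.+ suc n ℕ.* (c ℕ.* k)      ∎))

-- The ring of residues modulo p

module Residues (p : ℕ) .{{_ : NonZero p}} where

  open ≡-Reasoning

  %≡%⇒mod≡mod : ∀ {m n} → m % p ≡ n % p → m mod p ≡ n mod p
  %≡%⇒mod≡mod {m} {n} eq = toℕ-injective (begin
    toℕ (m mod p)  ≡⟨ toℕ-fromℕ< (m%n<n m p) ⟩
    m % p          ≡⟨ eq ⟩
    n % p          ≡⟨ toℕ-fromℕ< (m%n<n n p) ⟨
    toℕ (n mod p)  ∎)

  mod-toℕ : ∀ (x : 𝔽 p) → toℕ x mod p ≡ x
  mod-toℕ x = toℕ-injective (trans (toℕ-fromℕ< (m%n<n (toℕ x) p)) (m<n⇒m%n≡m (toℕ<n x)))

  mod-+ : ∀ m n → (m ℕ.+ n) mod p ≡ (m mod p) D.+ (n mod p)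
  mod-+ m n = %≡%⇒mod≡mod (trans (%-distribˡ-+ m n p)
    (sym (cong₂ (λ u v → (u ℕ.+ v) % p) (toℕ-fromℕ< (m%n<n m p)) (toℕ-fromℕ< (m%n<n n p)))))

  mod-* : ∀ m n → (m ℕ.* n) mod p ≡ (m mod p) D.* (n mod p)
  mod-* m n = %≡%⇒mod≡mod (trans (%-distribˡ-* m n p)
    (sym (cong₂ (λ u v → (u ℕ.* v) % p) (toℕ-fromℕ< (m%n<n m p)) (toℕ-fromℕ< (m%n<n n p)))))

  -- Every element is a value of the homomorphism _mod p, so identities are inherited from ℕ.
  +-mod : ∀ (x : 𝔽 p) m → x D.+ (m mod p) ≡ (toℕ x ℕ.+ m) mod p
  +-mod x m = trans (cong (D._+ (m mod p)) (sym (mod-toℕ x))) (sym (mod-+ (toℕ x) m))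

  mod+ : ∀ m (x : 𝔽 p) → (m mod p) D.+ x ≡ (m ℕ.+ toℕ x) mod p
  mod+ m x = trans (cong ((m mod p) D.+_) (sym (mod-toℕ x))) (sym (mod-+ m (toℕ x)))

  *-mod : ∀ (x : 𝔽 p) m → x D.* (m mod p) ≡ (toℕ x ℕ.* m) mod p
  *-mod x m = trans (cong (D._* (m mod p)) (sym (mod-toℕ x))) (sym (mod-* (toℕ x) m))

  mod* : ∀ m (x : 𝔽 p) → (m mod p) D.* x ≡ (m ℕ.* toℕ x) mod p
  mod* m x = trans (cong ((m mod p) D.*_) (sym (mod-toℕ x))) (sym (mod-* m (toℕ x)))

  p-mod-p : p mod p ≡ D.0#
  p-mod-p = %≡%⇒mod≡mod (trans (n%n≡0 p) (sym (m<n⇒m%n≡m (ℕ.>-nonZero⁻¹ p))))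

  +-comm : ∀ x y → x D.+ y ≡ y D.+ x
  +-comm x y = cong (_mod p) (ℕ.+-comm (toℕ x) (toℕ y))

  *-comm : ∀ x y → x D.* y ≡ y D.* x
  *-comm x y = cong (_mod p) (ℕ.*-comm (toℕ x) (toℕ y))

  +-identityˡ : ∀ x → D.0# D.+ x ≡ x
  +-identityˡ x = trans (mod+ 0 x) (mod-toℕ x)

  *-identityˡ : ∀ x → D.1# D.* x ≡ x
  *-identityˡ x = trans (mod* 1 x) (trans (cong (_mod p) (ℕ.*-identityˡ (toℕ x))) (mod-toℕ x))

  -‿inverseʳ : ∀ x → x D.+ D.- x ≡ D.0#
  -‿inverseʳ x = trans (+-mod x (p ∸ toℕ x)) (trans (cong (_mod p) (ℕ.m+[n∸m]≡n (ℕ.<⇒≤ (toℕ<n x)))) p-mod-p)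

  distribˡ : ∀ x y z → x D.* (y D.+ z) ≡ x D.* y D.+ x D.* z
  distribˡ x y z = begin
    x D.* (y D.+ z)                                  ≡⟨ *-mod x _ ⟩
    (toℕ x ℕ.* (toℕ y ℕ.+ toℕ z)) mod p
      ≡⟨ cong (_mod p) (ℕ.*-distribˡ-+ (toℕ x) (toℕ y) (toℕ z)) ⟩
    (toℕ x ℕ.* toℕ y ℕ.+ toℕ x ℕ.* toℕ z) mod p      ≡⟨ mod-+ (toℕ x ℕ.* toℕ y) (toℕ x ℕ.* toℕ z) ⟩
    x D.* y D.+ x D.* z                              ∎

  𝔽-isCommutativeRing : IsCommutativeRing _≡_ D._+_ D._*_ D.-_ D.0# D.1#
  𝔽-isCommutativeRing = record
    { isRing = record
      { +-isAbelianGroup = record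
        { isGroup = record
          { isMonoid = record
            { isSemigroup = record
              { isMagma = record { isEquivalence = isEquivalence ; ∙-cong = cong₂ D._+_ }
              ; assoc = λ x y z → trans (mod+ _ z)
                (trans (cong (_mod p) (ℕ.+-assoc (toℕ x) (toℕ y) (toℕ z))) (sym (+-mod x _)))
              }
            ; identity = +-identityˡ , λ x → trans (+-comm x D.0#) (+-identityˡ x)
            }
          ; inverse = (λ x → trans (+-comm (D.- x) x) (-‿inverseʳ x)) , -‿inverseʳ
          ; ⁻¹-cong = cong (λ x → D.- x)
          }
        ; comm = +-comm
        }
      ; *-cong = cong₂ D._*_
      ; *-assoc = λ x y z → trans (mod* _ z) (trans (cong (_mod p) (ℕ.*-assoc (toℕ x) (toℕ y) (toℕ z)))
        (sym (*-mod x _)))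
      ; *-identity = *-identityˡ , λ x → trans (*-comm x D.1#) (*-identityˡ x)
      ; distrib = distribˡ , λ x y z → trans (*-comm (y D.+ z) x)
        (trans (distribˡ x y z) (cong₂ D._+_ (*-comm x y) (*-comm x z)))
      }
    ; *-comm = *-comm
    }

-- The prime field: no zero divisors, and inverses

module PrimeField (p : ℕ) .{{_ : NonZero p}} (prime : Prime p) where

  open import Data.Fin.Subset using (_∈_; _∉_)
  open import Relation.Unary using (｛_｝)
  open ≡-Reasoning
  open Residues p using (%≡%⇒mod≡mod; mod-toℕ; mod-+; 𝔽-isCommutativeRing)
  open PropositionalRing 𝔽-isCommutativeRing
  open SubsetSum

  lookup-cong-⇔ : ∀ {m n} (A : Subset m) (B : Subset n) {x y} →
    (x ∈ A → y ∈ B) → (y ∈ B → x ∈ A) → lookup A x ≡ lookup B y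
  lookup-cong-⇔ A B {x} {y} to from with lookup A x in eqx | lookup B y in eqy
  ... | true  | true  = refl
  ... | false | false = refl
  ... | true  | false = trans (sym ([]=⇒lookup (to (lookup⇒[]= x A eqx)))) eqy
  ... | false | true  = trans (sym eqx) ([]=⇒lookup (from (lookup⇒[]= y B eqy)))

  1<p : 1 < p
  1<p = ℕ.nonTrivial⇒n>1 p {{prime⇒nonTrivial prime}}

  0%p≡0 : 0 % p ≡ 0
  0%p≡0 = m<n⇒m%n≡m (ℕ.<-trans (s≤s z≤n) 1<p)

  ι≡mod : ∀ n → ι n ≡ n mod p
  ι≡mod zero    = refl
  ι≡mod (suc n) = trans (cong (1# +_) (ι≡mod n)) (sym (mod-+ 1 n))

  ι-toℕ : ∀ x → ι (toℕ x) ≡ x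
  ι-toℕ x = trans (ι≡mod (toℕ x)) (mod-toℕ x)

  toℕ-ι : ∀ n → toℕ (ι n) ≡ n % p
  toℕ-ι n = trans (cong toℕ (ι≡mod n)) (toℕ-fromℕ< (m%n<n n p))

  ι≡0⇒p∣ : ∀ n → ι n ≡ 0# → p ∣ n
  ι≡0⇒p∣ n ι≡0 = m%n≡0⇒n∣m n p (trans (sym (toℕ-ι n)) (trans (cong toℕ ι≡0) (trans (toℕ-ι 0) 0%p≡0)))

  p∣⇒ι≡0 : ∀ n → p ∣ n → ι n ≡ 0#
  p∣⇒ι≡0 n p∣n = trans (ι≡mod n) (%≡%⇒mod≡mod (trans (n∣m⇒m%n≡0 n p p∣n) (sym 0%p≡0)))

  ι≢0 : ∀ n → 1 ≤ n → n < p → ι n ≢ 0#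
  ι≢0 (suc n) _ n<p ι≡0 = ℕ.<⇒≱ n<p (∣⇒≤ (ι≡0⇒p∣ (suc n) ι≡0))

  1≢0 : 1# ≢ 0#
  1≢0 1≡0 = ι≢0 1 ℕ.≤-refl 1<p (trans (+-identityʳ 1#) 1≡0)

  integral : ∀ {x y} → x * y ≡ 0# → x ≡ 0# ⊎ y ≡ 0#
  integral {x} {y} xy≡0 with euclidsLemma (toℕ x) (toℕ y) prime (ι≡0⇒p∣ (toℕ x ℕ.* toℕ y)
    (trans (×1-homo-* (toℕ x) (toℕ y)) (trans (cong₂ _*_ (ι-toℕ x) (ι-toℕ y)) xy≡0)))
  ... | inj₁ p∣x = inj₁ (trans (sym (ι-toℕ x)) (p∣⇒ι≡0 (toℕ x) p∣x))
  ... | inj₂ p∣y = inj₂ (trans (sym (ι-toℕ y)) (p∣⇒ι≡0 (toℕ y) p∣y))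

  open IntegralDomain integral

  inverse : ∀ x → x ≢ 0# → ∃[ y ] y * x ≡ 1#
  inverse x x≢0 with coprime-Bézout (prime⇒coprime prime {{nonZero}} (toℕ<n x))
    where
    nonZero : NonZero (toℕ x)
    nonZero = ℕ.≢-nonZero λ x≡0 → x≢0 (trans (sym (ι-toℕ x)) (cong ι x≡0))
  -- Bézout's identity reads `1 + v x = u p` here, so `- v` inverts `x`; in the other case it reads
  -- `1 + u p = v x`.
  ... | Bézout.+- u v eq = - ι v , x∙y⁻¹≈ε⇒x≈y _ _ (begin
        - ι v * x - 1#
          ≡⟨ solve 2 (λ v x → :- v :* x :- nat 1 := :- (nat 1 :+ v :* x)) refl (ι v) x ⟩
        - (1# + ι v * x)               ≡⟨ cong (λ t → - (1# + ι v * t)) (ι-toℕ x) ⟨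
        - (1# + ι v * ι (toℕ x))       ≡⟨ cong (λ t → - (1# + t)) (×1-homo-* v (toℕ x)) ⟨
        - ι (1 ℕ.+ v ℕ.* toℕ x)        ≡⟨ cong (λ t → - t) (p∣⇒ι≡0 _ (divides u eq)) ⟩
        - 0#                           ≡⟨ solve 0 (:- nat 0 := nat 0) refl ⟩
        0#                             ∎)
  ... | Bézout.-+ u v eq = ι v , (begin
        ι v * x                        ≡⟨ cong (ι v *_) (ι-toℕ x) ⟨
        ι v * ι (toℕ x)                ≡⟨ ×1-homo-* v (toℕ x) ⟨
        ι (v ℕ.* toℕ x)                ≡⟨ cong ι eq ⟨
        1# + ι (u ℕ.* p)               ≡⟨ cong (1# +_) (p∣⇒ι≡0 (u ℕ.* p) (divides u refl)) ⟩
        1# + 0#                        ≡⟨ +-identityʳ 1# ⟩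
        1#                             ∎)

  -- Polynomials and their roots

  -- A vector of length d holds the coefficients, lowest degree first, of a monic polynomial of
  -- degree d; the leading 1 is not stored.
  eval : ∀ {d} → Vec (𝔽 p) d → 𝔽 p → 𝔽 p
  eval []       x = 1#
  eval (c ∷ cs) x = c + x * eval cs x

  -- Synthetic division by `x - r`: the coefficients of the quotient are the Horner values of the
  -- tails at `r`.
  quotient : ∀ {d} → 𝔽 p → Vec (𝔽 p) (suc d) → Vec (𝔽 p) d
  quotient r (c ∷ [])          = []
  quotient r (c ∷ cs@(_ ∷ _))  = eval cs r ∷ quotient r cs

  eval-quotient : ∀ {d} r (cs : Vec (𝔽 p) (suc d)) x →
    eval cs x ≡ eval cs r + (x - r) * eval (quotient r cs) x
  eval-quotient r (c ∷ []) x = solve 3 (λ c r x → c :+ x :* nat 1 := c :+ r :* nat 1 :+ (x :- r) :* nat 1)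
    refl c r x
  eval-quotient r (c ∷ cs@(_ ∷ _)) x = begin
    c + x * eval cs x                     ≡⟨ cong (λ t → c + x * t) (eval-quotient r cs x) ⟩
    c + x * (e + (x - r) * q)
      ≡⟨ solve 5 (λ c x r e q → c :+ x :* (e :+ (x :- r) :* q) := c :+ r :* e :+ (x :- r) :* (e :+ x :* q))
        refl c x r e q ⟩
    c + r * e + (x - r) * (e + x * q)     ∎
    where
    e = eval cs r
    q = eval (quotient r cs) x

  -- Induction on the degree: one root is divided out and removed from `A`, and the others stay
  -- roots of the quotient because there are no zero divisors.
  roots≤degree : ∀ {d} (cs : Vec (𝔽 p) d) (A : Subset p) → (∀ {x} → x ∈ A → eval cs x ≡ 0#) → ∣ A ∣ ≤ d
  roots≤degree cs A root with nonempty? A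
  ... | no empty = subst (_≤ _) (sym (trans (cong ∣_∣ (Empty-unique empty)) (∣⊥∣≡0 p))) z≤n
  roots≤degree []          A root | yes (r , r∈A) = contradiction (root r∈A) 1≢0
  roots≤degree cs@(_ ∷ _)  A root | yes (r , r∈A) =
    ℕ.≤-trans (∣A∣≤1+∣A[x]≔outside∣ A r) (s≤s (roots≤degree (quotient r cs) (A [ r ]≔ outside) root′))
    where
    root′ : ∀ {x} → x ∈ A [ r ]≔ outside → eval (quotient r cs) x ≡ 0#
    root′ {x} x∈ with x ≟ r
    ... | yes refl = contradiction (trans (sym ([]=⇒lookup x∈)) (lookup∘update r A outside)) λ ()
    ... | no x≢r   = cancelˡ (λ x-r≡0 → x≢r (x∙y⁻¹≈ε⇒x≈y x r x-r≡0)) (begin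
        (x - r) * eval (quotient r cs) x               ≡⟨ +-identityˡ _ ⟨
        0# + (x - r) * eval (quotient r cs) x
          ≡⟨ cong (_+ (x - r) * eval (quotient r cs) x) (root r∈A) ⟨
        eval cs r + (x - r) * eval (quotient r cs) x   ≡⟨ eval-quotient r cs x ⟨
        eval cs x
          ≡⟨ root (lookup⇒[]= x A (trans (sym (lookup∘update′ x≢r A outside)) ([]=⇒lookup x∈))) ⟩
        0#                                             ∎)

  eval-replicate-0 : ∀ d x → eval (replicate d 0#) x ≡ x ^ d
  eval-replicate-0 zero    x = refl
  eval-replicate-0 (suc d) x = trans (+-identityˡ _) (cong (x *_) (eval-replicate-0 d x))

  x^[1+d]≡1⇒∣A∣≤1+d : ∀ d (A : Subset p) → (∀ {x} → x ∈ A → x ^ suc d ≡ 1#) → ∣ A ∣ ≤ suc d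
  -- The vector encodes `X^(d + 1) - 1`.
  x^[1+d]≡1⇒∣A∣≤1+d d A x^[1+d]≡1 = roots≤degree (- 1# ∷ replicate d 0#) A λ {x} x∈A → begin
    - 1# + x * eval (replicate d 0#) x  ≡⟨ cong (λ t → - 1# + x * t) (eval-replicate-0 d x) ⟩
    - 1# + x ^ suc d                    ≡⟨ cong (- 1# +_) (x^[1+d]≡1 x∈A) ⟩
    - 1# + 1#                           ≡⟨ -‿inverseˡ 1# ⟩
    0#                                  ∎

  dilation : ∀ c d → d * c ≡ 1# → Permutation′ p
  dilation c d dc≡1 = permutation (c *_) (d *_) (λ x → undo c d x (trans (*-comm c d) dc≡1))
    (λ x → undo d c x dc≡1)
    where
    undo : ∀ u v x → u * v ≡ 1# → u * (v * x) ≡ x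
    undo u v x uv≡1 = trans (sym (*-assoc u v x)) (trans (cong (_* x) uv≡1) (*-identityˡ x))

  translation : 𝔽 p → Permutation′ p
  translation c = permutation (c +_) (- c +_)
    (λ x → solve 2 (λ c x → c :+ (:- c :+ x) := x) refl c x)
    (λ x → solve 2 (λ c x → :- c :+ (c :+ x) := x) refl c x)

  -- Multiplicative subgroups: orders and power sums

  module Subgroup {A : Subset p} (A-subgroup : IsMultiplicativeSubgroup A) where

    open IsMultiplicativeSubgroup A-subgroup public using (0∉; 1∈; *-closed) renaming (inverse to ∈-inverse)

    inverseˡ : ∀ {c} → c ∈ A → ∃[ d ] (d ∈ A × d * c ≡ 1#)
    inverseˡ {c} c∈A with d , d∈A , cd≡1 ← ∈-inverse c∈A = d , d∈A , trans (*-comm d c) cd≡1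

    lookup-* : ∀ {c} → c ∈ A → ∀ x → lookup A (c * x) ≡ lookup A x
    lookup-* {c} c∈A x with d , d∈A , dc≡1 ← inverseˡ c∈A = lookup-cong-⇔ A A
      (λ cx∈A → subst (_∈ A) (trans (sym (*-assoc d c x)) (trans (cong (_* x) dc≡1) (*-identityˡ x)))
        (*-closed d∈A cx∈A))
      (*-closed c∈A)

    order : ℕ
    order = ∣ A ∣

    -- Multiplication by `c` permutes `A`, hence multiplies the product of its elements by
    -- `c ^ order` without changing it; that product is nonzero and cancels. Setting `f` to 1 off
    -- `A` lets the product run over all residues.
    ^-order : ∀ {c} → c ∈ A → c ^ order ≡ 1#
    ^-order {c} c∈A with d , _ , dc≡1 ← inverseˡ c∈A = x∙y⁻¹≈ε⇒x≈y _ _ (cancelˡ (product≢0 f f≢0) (begin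
      Π.sum f * (c ^ order - 1#)
        ≡⟨ solve 2 (λ q t → q :* (t :- nat 1) := t :* q :- q) refl (Π.sum f) (c ^ order) ⟩
      c ^ order * Π.sum f - Π.sum f                ≡⟨ cong (_- Π.sum f) dilated ⟨
      Π.sum f - Π.sum f                            ≡⟨ -‿inverseʳ _ ⟩
      0#                                           ∎))
      where
      module Π = Algebra.Properties.CommutativeMonoid.Sum *-commutativeMonoid
      f : 𝔽 p → 𝔽 p
      f x = if lookup A x then x else 1#

      product≢0 : ∀ {n} (g : Fin n → 𝔽 p) → (∀ i → g i ≢ 0#) → Π.sum g ≢ 0#
      product≢0 {zero}  g g≢0 = 1≢0
      product≢0 {suc n} g g≢0 = *-≢0 (g≢0 zero) (product≢0 (g ∘ suc) (g≢0 ∘ suc))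

      f≢0 : ∀ x → f x ≢ 0#
      f≢0 x with lookup A x in eq
      ... | false = 1≢0
      ... | true  = λ { refl → 0∉ (lookup⇒[]= _ A eq) }

      f-* : ∀ x → f (c * x) ≡ (if lookup A x then c else 1#) * f x
      f-* x rewrite lookup-* c∈A x with lookup A x
      ... | true  = refl
      ... | false = sym (*-identityˡ 1#)

      dilated : Π.sum f ≡ c ^ order * Π.sum f
      dilated = begin
        Π.sum f
          ≡⟨ Π.sum-permute f (dilation c d dc≡1) ⟩
        Π.sum (λ x → f (c * x))                                       ≡⟨ Π.sum-cong-≗ f-* ⟩
        Π.sum (λ x → (if lookup A x then c else 1#) * f x)
          ≡⟨ Π.∑-distrib-+ (λ x → if lookup A x then c else 1#) f ⟩
        Π.sum (λ x → if lookup A x then c else 1#) * Π.sum f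
          ≡⟨ cong (_* Π.sum f) (sum-indicator *-commutativeMonoid A c) ⟩
        c ^ order * Π.sum f                                           ∎

    order≥1 : 1 ≤ order
    order≥1 = ℕ.≤-trans (ℕ.≤-reflexive (sym (∣⁅x⁆∣≡1 1#)))
      (p⊆q⇒∣p∣≤∣q∣ λ x∈⁅1⁆ → subst (_∈ A) (sym (x∈⁅y⁆⇒x≡y _ x∈⁅1⁆)) 1∈)

    -- The remainder `r` of `j` also satisfies `c ^ r = 1` on `A`. A positive `r` would give
    -- `X^r - 1` more than `r` roots.
    exponent⇒order∣ : ∀ j → (∀ {c} → c ∈ A → c ^ j ≡ 1#) → order ∣ j
    exponent⇒order∣ j c^j≡1 = m%n≡0⇒n∣m j order (remainder (j % order) refl)
      where
      instance
        order-nonZero : NonZero order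
        order-nonZero = ℕ.>-nonZero order≥1
      c^r≡1 : ∀ {c} → c ∈ A → c ^ (j % order) ≡ 1#
      c^r≡1 {c} c∈A = begin
        c ^ (j % order)                                    ≡⟨ *-identityʳ _ ⟨
        c ^ (j % order) * 1#
          ≡⟨ cong (c ^ (j % order) *_) (1^n≡1 (j / order)) ⟨
        c ^ (j % order) * 1# ^ (j / order)
          ≡⟨ cong (λ t → c ^ (j % order) * t ^ (j / order)) (^-order c∈A) ⟨
        c ^ (j % order) * (c ^ order) ^ (j / order)
          ≡⟨ cong (c ^ (j % order) *_) (^-assocʳ c order (j / order)) ⟩
        c ^ (j % order) * c ^ (order ℕ.* (j / order))
          ≡⟨ ^-homo-* c (j % order) (order ℕ.* (j / order)) ⟨
        c ^ (j % order ℕ.+ order ℕ.* (j / order))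
          ≡⟨ cong (λ t → c ^ (j % order ℕ.+ t)) (ℕ.*-comm order (j / order)) ⟩
        c ^ (j % order ℕ.+ j / order ℕ.* order)            ≡⟨ cong (c ^_) (m≡m%n+[m/n]*n j order) ⟨
        c ^ j                                              ≡⟨ c^j≡1 c∈A ⟩
        1#                                                 ∎
      remainder : ∀ r → j % order ≡ r → j % order ≡ 0
      remainder zero    eq = eq
      remainder (suc r) eq = contradiction
        (x^[1+d]≡1⇒∣A∣≤1+d r A (λ {c} c∈A → subst (λ t → c ^ t ≡ 1#) eq (c^r≡1 c∈A)))
        (ℕ.<⇒≱ (subst (_< order) eq (m%n<n j order)))

    weight : 𝔽 p → 𝔽 p
    weight x = if lookup A x then 1# else 0#

    open PowerSums weight (λ x → x) public
    open Exclusion weight (λ x → x) public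

    weight-cong : ∀ {x y z} → (x ∈ A → y ≡ z) → weight x * y ≡ weight x * z
    weight-cong {x} y≡z with lookup A x in eq
    ... | true  = cong (1# *_) (y≡z (lookup⇒[]= x A eq))
    ... | false = trans (zeroˡ _) (sym (zeroˡ _))

    L-dilate : ∀ {c} → c ∈ A → ∀ h → L h ≡ L (λ x → h (c * x))
    L-dilate {c} c∈A h with d , _ , dc≡1 ← inverseˡ c∈A = begin
      L h
        ≡⟨ sum-permute (λ x → weight x * h x) (dilation c d dc≡1) ⟩
      ∑[ x < p ] (weight (c * x) * h (c * x))
        ≡⟨ sum-cong-≗ (λ x → cong (λ t → (if t then 1# else 0#) * h (c * x)) (lookup-* c∈A x)) ⟩
      L (λ x → h (c * x))                              ∎

    -- Dilating by `c ∈ A` gives `P j = c^j P j`. If `P j` were nonzero, every `c^j` would be 1, and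
    -- `order` would divide `j`.
    P-vanishes : ∀ j → ¬ order ∣ j → P j ≡ 0#
    P-vanishes j ∤j with P j ≟ 0#
    ... | yes P≡0 = P≡0
    ... | no  P≢0 = contradiction (exponent⇒order∣ j λ {c} c∈A → x∙y⁻¹≈ε⇒x≈y _ _ (cancelˡ P≢0 (begin
        P j * (c ^ j - 1#)
          ≡⟨ solve 2 (λ q t → q :* (t :- nat 1) := t :* q :- q) refl (P j) (c ^ j) ⟩
        c ^ j * P j - P j                              ≡⟨ cong (_- P j) (scale c∈A) ⟨
        P j - P j                                      ≡⟨ -‿inverseʳ _ ⟩
        0#                                             ∎))) ∤j
      where
      scale : ∀ {c} → c ∈ A → P j ≡ c ^ j * P j
      scale {c} c∈A = begin
        P j                                            ≡⟨ L-dilate c∈A (_^ j) ⟩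
        L (λ x → (c * x) ^ j)
          ≡⟨ sum-cong-≗ (λ x → trans (cong (weight x *_) (^-distrib-* c x j))
                                                            (solve 3 (λ w u v → w :* (u :* v) := u :*
                                                              (w :* v)) refl (weight x) (c ^ j) (x ^ j))) ⟩
        ∑[ x < p ] (c ^ j * (weight x * x ^ j))        ≡⟨ *-distribˡ-sum (c ^ j) (λ x → weight x * x ^ j) ⟨
        c ^ j * P j                                    ∎

    weight-order : ∀ x → weight x * x ^ order ≡ weight x
    weight-order x = trans (weight-cong ^-order) (*-identityʳ (weight x))

  -- Counting pairs by their difference

  module ℕ∑ = Algebra.Properties.Semiring.Sum ℕ.+-*-semiring

  n·1≡n : ∀ n → Algebra.Definitions.RawMonoid._×_ ℕ.+-0-rawMonoid n 1 ≡ n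
  n·1≡n zero    = refl
  n·1≡n (suc n) = cong suc (n·1≡n n)

  sum-𝟙 : ∀ (A : Subset p) → ℕ∑.sum (D.𝟙 A) ≡ ∣ A ∣
  sum-𝟙 A = trans (sum-indicator ℕ.+-0-commutativeMonoid A 1) (n·1≡n ∣ A ∣)

  term≤sum : ∀ {n} (f : Fin n → ℕ) i → f i ≤ ℕ∑.sum f
  term≤sum f zero    = ℕ.m≤m+n _ _
  term≤sum f (suc i) = ℕ.≤-trans (term≤sum (f ∘ suc) i) (ℕ.m≤n+m _ (f zero))

  𝟙-∈ : ∀ {A : Subset p} {x} → x ∈ A → D.𝟙 A x ≡ 1
  𝟙-∈ x∈A = cong (λ b → if b then 1 else 0) ([]=⇒lookup x∈A)

  𝟙-∉ : ∀ {A : Subset p} {x} → x ∉ A → D.𝟙 A x ≡ 0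
  𝟙-∉ {A} {x} x∉A with lookup A x in eq
  ... | true  = contradiction (lookup⇒[]= x A eq) x∉A
  ... | false = refl

  -- After the sums are exchanged, translation by `y` turns the inner sum into the size of `A`.
  sum-⊚ : ∀ (A : Subset p) → ℕ∑.sum (A D.⊚ A) ≡ ∣ A ∣ ℕ.* ∣ A ∣
  sum-⊚ A = begin
    ℕ∑.sum (λ x → ℕ∑.sum (λ y → D.𝟙 A y ℕ.* D.𝟙 A (y + x)))
      ≡⟨ ℕ∑.∑-comm (λ x y → D.𝟙 A y ℕ.* D.𝟙 A (y + x)) ⟩
    ℕ∑.sum (λ y → ℕ∑.sum (λ x → D.𝟙 A y ℕ.* D.𝟙 A (y + x)))   ≡⟨ ℕ∑.sum-cong-≗ inner ⟩
    ℕ∑.sum (λ y → D.𝟙 A y ℕ.* ∣ A ∣)                            ≡⟨ ℕ∑.*-distribʳ-sum ∣ A ∣ (D.𝟙 A) ⟨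
    ℕ∑.sum (D.𝟙 A) ℕ.* ∣ A ∣                                    ≡⟨ cong (ℕ._* ∣ A ∣) (sum-𝟙 A) ⟩
    ∣ A ∣ ℕ.* ∣ A ∣                                             ∎
    where
    inner : ∀ y → ℕ∑.sum (λ x → D.𝟙 A y ℕ.* D.𝟙 A (y + x)) ≡ D.𝟙 A y ℕ.* ∣ A ∣
    inner y = begin
      ℕ∑.sum (λ x → D.𝟙 A y ℕ.* D.𝟙 A (y + x))      ≡⟨ ℕ∑.*-distribˡ-sum (D.𝟙 A y) (λ x → D.𝟙 A (y + x)) ⟨
      D.𝟙 A y ℕ.* ℕ∑.sum (λ x → D.𝟙 A (y + x))
        ≡⟨ cong (D.𝟙 A y ℕ.*_) (ℕ∑.sum-permute (D.𝟙 A) (translation y)) ⟨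
      D.𝟙 A y ℕ.* ℕ∑.sum (D.𝟙 A)                    ≡⟨ cong (D.𝟙 A y ℕ.*_) (sum-𝟙 A) ⟩
      D.𝟙 A y ℕ.* ∣ A ∣                              ∎

  ⊚-0 : ∀ (A : Subset p) → (A D.⊚ A) 0# ≡ ∣ A ∣
  ⊚-0 A = trans (ℕ∑.sum-cong-≗ λ y → trans (cong (λ t → D.𝟙 A y ℕ.* D.𝟙 A t) (+-identityʳ y)) (idem y))
    (sum-𝟙 A)
    where
    idem : ∀ y → D.𝟙 A y ℕ.* D.𝟙 A y ≡ D.𝟙 A y
    idem y with lookup A y
    ... | true  = refl
    ... | false = refl

  -- Consequences of the shape of the difference set

  module Difference
    {A Γ : Subset p} (A-subgroup : IsMultiplicativeSubgroup A) (Γ-subgroup : IsMultiplicativeSubgroup Γ)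
    {ξ : 𝔽 p} (ξ≢0 : ξ ≢ 0#) (A⊖A≐ : A D.⊖ A D.≐ ξ D.⊙ Γ ⊔ ｛ 0# ｝)
    where

    module A = Subgroup A-subgroup
    module Γ = Subgroup Γ-subgroup

    a g : ℕ
    a = ∣ A ∣
    g = ∣ Γ ∣

    difference : ∀ {x} → (A D.⊖ A) x → x ≢ 0# → (ξ D.⊙ Γ) x
    difference x∈A⊖A x≢0 with proj₁ (proj₁ A⊖A≐) x∈A⊖A
    ... | inj₁ x∈ξΓ = x∈ξΓ
    ... | inj₂ 0≡x  = contradiction (sym 0≡x) x≢0

    ξ∈A⊖A : (A D.⊖ A) ξ
    ξ∈A⊖A = proj₂ (proj₁ A⊖A≐) (inj₁ (1# , Γ.1∈ , sym (*-identityʳ ξ)))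

    -- `A - A` is stable under multiplication by `x ∈ A` and contains `ξ`, so the nonzero element
    -- `x * ξ` lies in `ξ Γ`, and `ξ` cancels.
    A⊆Γ : ∀ {x} → x ∈ A → x ∈ Γ
    A⊆Γ {x} x∈A = dilate-ξ ξ∈A⊖A
      where
      cancel-ξ : (ξ D.⊙ Γ) (x * ξ) → x ∈ Γ
      cancel-ξ (γ , γ∈Γ , xξ≡ξγ) = subst (_∈ Γ) (sym (x∙y⁻¹≈ε⇒x≈y x γ (cancelˡ ξ≢0 (begin
        ξ * (x - γ)      ≡⟨ solve 3 (λ ξ x γ → ξ :* (x :- γ) := x :* ξ :- ξ :* γ) refl ξ x γ ⟩
        x * ξ - ξ * γ    ≡⟨ cong (_- ξ * γ) xξ≡ξγ ⟩
        ξ * γ - ξ * γ    ≡⟨ -‿inverseʳ _ ⟩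
        0#               ∎)))) γ∈Γ

      dilate-ξ : (A D.⊖ A) ξ → x ∈ Γ
      dilate-ξ (b , b′ , b∈A , b′∈A , ξ≡b-b′) = cancel-ξ (difference
        (x * b , x * b′ , A.*-closed x∈A b∈A , A.*-closed x∈A b′∈A ,
          trans (cong (x *_) ξ≡b-b′) (solve 3 (λ x b b′ → x :* (b :- b′) := x :* b :- x :* b′) refl x b b′))
        (*-≢0 (λ x≡0 → A.0∉ (subst (_∈ A) x≡0 x∈A)) ξ≢0))

    a∣g : a ∣ g
    a∣g = A.exponent⇒order∣ g (Γ.^-order ∘ A⊆Γ)

    [1-x]^g : ∀ {x} → x ∈ A → x ≢ 1# → (1# - x) ^ g ≡ ξ ^ g
    [1-x]^g {x} x∈A x≢1 with γ , γ∈Γ , 1-x≡ξγ ← difference (1# , x , A.1∈ , x∈A , refl)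
                               (λ 1-x≡0 → x≢1 (sym (x∙y⁻¹≈ε⇒x≈y 1# x 1-x≡0))) = begin
      (1# - x) ^ g       ≡⟨ cong (_^ g) 1-x≡ξγ ⟩
      (ξ * γ) ^ g        ≡⟨ ^-distrib-* ξ γ g ⟩
      ξ ^ g * γ ^ g      ≡⟨ cong (ξ ^ g *_) (Γ.^-order γ∈Γ) ⟩
      ξ ^ g * 1#         ≡⟨ *-identityʳ _ ⟩
      ξ ^ g              ∎

    [1-1]^ : ∀ j → 1 ≤ j → (1# - 1#) ^ j ≡ 0#
    [1-1]^ (suc j) _ = trans (cong (_* (1# - 1#) ^ j) (-‿inverseʳ 1#)) (zeroˡ _)

    -- The element 1, to which `[1-x]^g` does not apply, contributes 0 to both sides because
    -- `j ≥ 1`.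
    S-shift : ∀ j → 1 ≤ j → A.S (g ℕ.+ j) ≡ ξ ^ g * A.S j
    S-shift j 1≤j = begin
      A.S (g ℕ.+ j)
        ≡⟨ sum-cong-≗ (λ x → A.weight-cong (term x)) ⟩
      ∑[ x < p ] (A.weight x * (ξ ^ g * (x * (1# - x) ^ j)))
        ≡⟨ sum-cong-≗ (λ x → solve 3 (λ w t y → w :* (t :* y) := t :* (w :* y)) refl (A.weight x) (ξ ^ g)
          (x * (1# - x) ^ j)) ⟩
      ∑[ x < p ] (ξ ^ g * (A.weight x * (x * (1# - x) ^ j)))
        ≡⟨ *-distribˡ-sum (ξ ^ g) (λ x → A.weight x * (x * (1# - x) ^ j)) ⟨
      ξ ^ g * A.S j ∎
      where
      term : ∀ x → x ∈ A → x * (1# - x) ^ (g ℕ.+ j) ≡ ξ ^ g * (x * (1# - x) ^ j)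
      term x x∈A with x ≟ 1#
      ... | yes refl = trans (cong (1# *_) ([1-1]^ (g ℕ.+ j) (ℕ.≤-trans 1≤j (ℕ.m≤n+m j g))))
                        (trans (solve 1 (λ t → nat 1 :* nat 0 := t :* (nat 1 :* nat 0)) refl (ξ ^ g))
                        (cong (λ t → ξ ^ g * (1# * t)) (sym ([1-1]^ j 1≤j))))
      ... | no x≢1 = begin
        x * (1# - x) ^ (g ℕ.+ j)              ≡⟨ cong (x *_) (^-homo-* (1# - x) g j) ⟩
        x * ((1# - x) ^ g * (1# - x) ^ j)     ≡⟨ cong (λ t → x * (t * (1# - x) ^ j)) ([1-x]^g x∈A x≢1) ⟩
        x * (ξ ^ g * (1# - x) ^ j)
          ≡⟨ solve 3 (λ x t y → x :* (t :* y) := t :* (x :* y)) refl x (ξ ^ g) ((1# - x) ^ j) ⟩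
        ξ ^ g * (x * (1# - x) ^ j)            ∎

    ξ^g≢0 : ξ ^ g ≢ 0#
    ξ^g≢0 = power≢0 g
      where
      power≢0 : ∀ j → ξ ^ j ≢ 0#
      power≢0 zero    = 1≢0
      power≢0 (suc j) = *-≢0 ξ≢0 (power≢0 j)

    -- With `j = 0` the element 1 does matter: `(1 - 1)^g` is 0 and not `ξ^g`. The discrepancy `h`
    -- is supported there and contributes `- ξ^g`; the rest is `ξ^g * P 1`, which is 0 because
    -- `a ≥ 2`.
    S-g : 2 ≤ a → A.S g ≡ - (ξ ^ g)
    S-g 2≤a = begin
      A.S g
        ≡⟨ sum-cong-≗
          (λ x → solve 4 (λ w x y t → w :* (x :* y) := w :* (x :* (y :- t)) :+ t :* (w :* (x :* nat 1)))
             refl (A.weight x) x ((1# - x) ^ g) (ξ ^ g)) ⟩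
      ∑[ x < p ] (h x + ξ ^ g * (A.weight x * x ^ 1))
        ≡⟨ ∑-distrib-+ h (λ x → ξ ^ g * (A.weight x * x ^ 1)) ⟩
      sum h + ∑[ x < p ] (ξ ^ g * (A.weight x * x ^ 1))
        ≡⟨ cong₂ _+_ (sum-supported-at +-commutativeMonoid 1# h h-support)
          (sym (*-distribˡ-sum (ξ ^ g) (λ x → A.weight x * x ^ 1))) ⟩
      h 1# + ξ ^ g * A.P 1
        ≡⟨ cong₂ (λ u v → u + ξ ^ g * v) h-1 (A.P-vanishes 1 λ a∣1 → ℕ.<⇒≱ 2≤a (∣⇒≤ a∣1)) ⟩
      - (ξ ^ g) + ξ ^ g * 0#
        ≡⟨ solve 1 (λ t → :- t :+ t :* nat 0 := :- t) refl (ξ ^ g) ⟩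
      - (ξ ^ g) ∎
      where
      h : 𝔽 p → 𝔽 p
      h x = A.weight x * (x * ((1# - x) ^ g - ξ ^ g))
      h-support : ∀ x → x ≢ 1# → h x ≡ 0#
      h-support x x≢1 = trans (A.weight-cong {z = 0#} λ x∈A → trans
        (cong (x *_) (trans (cong (_- ξ ^ g) ([1-x]^g x∈A x≢1)) (-‿inverseʳ _))) (zeroʳ x))
          (zeroʳ (A.weight x))
      h-1 : h 1# ≡ - (ξ ^ g)
      h-1 = trans (cong₂ (λ b y → (if b then 1# else 0#) * (1# * (y - ξ ^ g))) ([]=⇒lookup A.1∈)
        ([1-1]^ g Γ.order≥1))
        (solve 1 (λ t → nat 1 :* (nat 1 :* (nat 0 :- t)) := :- t) refl (ξ ^ g))

    module _ (c : ℕ) (A⊚A≡c : ∀ x → (ξ D.⊙ Γ) x → (A D.⊚ A) x ≡ c) where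

      atZero : 𝔽 p → ℕ
      atZero x = if does (x ≟ 0#) then a else 0

      atZero-0 : ∀ {x} → x ≡ 0# → atZero x ≡ a
      atZero-0 {x} x≡0 = cong (λ b → if b then a else 0) (dec-true (x ≟ 0#) x≡0)

      atZero-≢0 : ∀ {x} → x ≢ 0# → atZero x ≡ 0
      atZero-≢0 {x} x≢0 = cong (λ b → if b then a else 0) (dec-false (x ≟ 0#) x≢0)

      ⊚-outside : ∀ {x} → x ≢ 0# → ¬ (ξ D.⊙ Γ) x → (A D.⊚ A) x ≡ 0
      ⊚-outside {x} x≢0 x∉ξΓ = trans (ℕ∑.sum-cong-≗ λ y → term y (y ∈? A) (y + x ∈? A))
        (ℕ∑.sum-replicate-zero p)
        where
        term : ∀ y → Dec (y ∈ A) → Dec (y + x ∈ A) → D.𝟙 A y ℕ.* D.𝟙 A (y + x) ≡ 0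
        term y (no y∉A)  _            = cong (ℕ._* D.𝟙 A (y + x)) (𝟙-∉ y∉A)
        term y (yes _)   (no y+x∉A)   = trans (cong (D.𝟙 A y ℕ.*_) (𝟙-∉ y+x∉A)) (ℕ.*-zeroʳ (D.𝟙 A y))
        term y (yes y∈A) (yes y+x∈A)  = contradiction
          (difference (y + x , y , y+x∈A , y∈A , solve 2 (λ x y → x := y :+ x :- y) refl x y) x≢0) x∉ξΓ

      module _ {ζ : 𝔽 p} (ζξ≡1 : ζ * ξ ≡ 1#) where

        ζξ-cancel : ∀ x → ζ * (ξ * x) ≡ x
        ζξ-cancel x = trans (sym (*-assoc ζ ξ x)) (trans (cong (_* x) ζξ≡1) (*-identityˡ x))

        ξζ-cancel : ∀ x → ξ * (ζ * x) ≡ x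
        ξζ-cancel x = trans (solve 3 (λ ξ ζ x → ξ :* (ζ :* x) := ζ :* (ξ :* x)) refl ξ ζ x) (ζξ-cancel x)

        -- The inverse `ζ` of `ξ` replaces membership in `ξ Γ` by the decidable `ζ * x ∈ Γ`, so that
        -- summing over `x` reduces to a dilation of `Γ`.
        ⊚-decompose : ∀ x → Dec (x ≡ 0#) → Dec (ζ * x ∈ Γ) →
          (A D.⊚ A) x ≡ atZero x ℕ.+ c ℕ.* D.𝟙 Γ (ζ * x)
        ⊚-decompose x (yes x≡0) _ = begin
          (A D.⊚ A) x                         ≡⟨ cong (A D.⊚ A) x≡0 ⟩
          (A D.⊚ A) 0#                        ≡⟨ ⊚-0 A ⟩
          a                                   ≡⟨ ℕ.+-identityʳ a ⟨
          a ℕ.+ 0                             ≡⟨ cong (a ℕ.+_) (ℕ.*-zeroʳ c) ⟨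
          a ℕ.+ c ℕ.* 0
            ≡⟨ cong₂ (λ t u → t ℕ.+ c ℕ.* u) (atZero-0 x≡0)
              (𝟙-∉ (subst (_∉ Γ) (sym (trans (cong (ζ *_) x≡0) (zeroʳ ζ))) Γ.0∉)) ⟨
          atZero x ℕ.+ c ℕ.* D.𝟙 Γ (ζ * x)    ∎
        ⊚-decompose x (no x≢0) (yes ζx∈Γ) = begin
          (A D.⊚ A) x                         ≡⟨ A⊚A≡c x (ζ * x , ζx∈Γ , sym (ξζ-cancel x)) ⟩
          c                                   ≡⟨ ℕ.*-identityʳ c ⟨
          c ℕ.* 1                             ≡⟨ cong₂ (λ t u → t ℕ.+ c ℕ.* u) (atZero-≢0 x≢0) (𝟙-∈ ζx∈Γ) ⟨
          atZero x ℕ.+ c ℕ.* D.𝟙 Γ (ζ * x)    ∎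
        ⊚-decompose x (no x≢0) (no ζx∉Γ) = begin
          (A D.⊚ A) x                         ≡⟨ ⊚-outside x≢0 (λ (γ , γ∈Γ , x≡ξγ) →
                                                   ζx∉Γ (subst (_∈ Γ)
                                                     (sym (trans (cong (ζ *_) x≡ξγ) (ζξ-cancel γ))) γ∈Γ)) ⟩
          0                                   ≡⟨ ℕ.*-zeroʳ c ⟨
          c ℕ.* 0                             ≡⟨ cong₂ (λ t u → t ℕ.+ c ℕ.* u) (atZero-≢0 x≢0) (𝟙-∉ ζx∉Γ) ⟨
          atZero x ℕ.+ c ℕ.* D.𝟙 Γ (ζ * x)    ∎

        count : a ℕ.* a ≡ a ℕ.+ c ℕ.* g
        count = begin
          a ℕ.* a
            ≡⟨ sum-⊚ A ⟨
          ℕ∑.sum (A D.⊚ A)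
            ≡⟨ ℕ∑.sum-cong-≗ (λ x → ⊚-decompose x (x ≟ 0#) (ζ * x ∈? Γ)) ⟩
          ℕ∑.sum (λ x → atZero x ℕ.+ c ℕ.* D.𝟙 Γ (ζ * x))
            ≡⟨ ℕ∑.∑-distrib-+ atZero (λ x → c ℕ.* D.𝟙 Γ (ζ * x)) ⟩
          ℕ∑.sum atZero ℕ.+ ℕ∑.sum (λ x → c ℕ.* D.𝟙 Γ (ζ * x))
            ≡⟨ cong₂ ℕ._+_ (sum-supported-at ℕ.+-0-commutativeMonoid 0# atZero (λ x → atZero-≢0))
              (sym (ℕ∑.*-distribˡ-sum c (λ x → D.𝟙 Γ (ζ * x)))) ⟩
          atZero 0# ℕ.+ c ℕ.* ℕ∑.sum (λ x → D.𝟙 Γ (ζ * x))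
            ≡⟨ cong₂ (λ u v → u ℕ.+ c ℕ.* v) (atZero-0 refl)
              (sym (ℕ∑.sum-permute (D.𝟙 Γ) (dilation ζ ξ (trans (*-comm ξ ζ) ζξ≡1)))) ⟩
          a ℕ.+ c ℕ.* ℕ∑.sum (D.𝟙 Γ)
            ≡⟨ cong (λ t → a ℕ.+ c ℕ.* t) (sum-𝟙 Γ) ⟩
          a ℕ.+ c ℕ.* g ∎

      counting : a ℕ.* a ≡ a ℕ.+ c ℕ.* g
      counting = count {proj₁ (inverse ξ ξ≢0)} (proj₂ (inverse ξ ξ≢0))

      -- A pair with difference `ξ` contributes 1 to the correlation at `ξ`.
      c≥1 : 1 ≤ c
      c≥1 = at-ξ ξ∈A⊖A
        where
        at-ξ : (A D.⊖ A) ξ → 1 ≤ c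
        at-ξ (b , b′ , b∈A , b′∈A , ξ≡b-b′) = ℕ.≤-trans
          (ℕ.≤-reflexive (sym (cong₂ ℕ._*_ (𝟙-∈ b′∈A) (𝟙-∈ (subst (_∈ A)
            (trans (solve 2 (λ b b′ → b := b′ :+ (b :- b′)) refl b b′) (cong (b′ +_) (sym ξ≡b-b′))) b∈A)))))
          (ℕ.≤-trans (term≤sum (λ y → D.𝟙 A y ℕ.* D.𝟙 A (y + ξ)) b′)
            (ℕ.≤-reflexive (A⊚A≡c ξ (1# , Γ.1∈ , sym (*-identityʳ ξ)))))

      excluded : 4 ≤ a → ¬ 2 ℕ.* g < p
      excluded 4≤a 2g<p = exclude (ℕ.pred a) (_∣_.quotient a∣g) 1+pred-a≡a
        (trans (cong (ℕ._* _∣_.quotient a∣g) 1+pred-a≡a)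
          (trans (ℕ.*-comm a (_∣_.quotient a∣g)) (sym (_∣_.equality a∣g))))
        where
        1+pred-a≡a : suc (ℕ.pred a) ≡ a
        1+pred-a≡a = ℕ.suc-pred a {{ℕ.>-nonZero A.order≥1}}

        exclude : ∀ n k → suc n ≡ a → suc n ℕ.* k ≡ g → ⊥
        exclude n k 1+n≡a g≡ = [ k≮n 1≤k , k≢n (ℕ.≤-pred (subst (4 ≤_) (sym 1+n≡a) 4≤a)) ]′
          (ℕ.m≤n⇒m<n∨m≡n k≤n)
          where
          k≤n : k ≤ n
          k≤n = [1+n]²≡[1+n]+c[1+n]k⇒k≤n (subst (λ t → t ℕ.* t ≡ t ℕ.+ c ℕ.* (suc n ℕ.* k)) (sym 1+n≡a)
            (trans counting (cong (λ t → a ℕ.+ c ℕ.* t) (sym g≡)))) c≥1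
          1≤k : 1 ≤ k
          1≤k = ℕ.n≢0⇒n>0 λ { refl → ℕ.<⇒≢ Γ.order≥1 (trans (sym (ℕ.*-zeroʳ n)) g≡) }
          n<g : n < g
          n<g = subst (_≤ g) (sym 1+n≡a) (∣⇒≤ {{ℕ.>-nonZero Γ.order≥1}} a∣g)
          -- Here `2 g < p` is used: `n < a ≤ g` gives `g + n < 2 g < p`, so the integers from 1 to
          -- `g + n` are nonzero in the field.
          in-range : ∀ {j} → j ≤ suc n ℕ.* k ℕ.+ n → j < p
          in-range j≤ = ℕ.≤-<-trans j≤ (ℕ.≤-<-trans (ℕ.≤-reflexive (cong (ℕ._+ n) g≡))
            (ℕ.<-trans (ℕ.+-monoʳ-< g n<g)
            (subst (_< p) (cong (g ℕ.+_) (ℕ.+-identityʳ g)) 2g<p)))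
          open A.Parameters integral n k
            (λ j 1≤j j≤ → ι≢0 j 1≤j (in-range j≤))
            (λ j ∤j → A.P-vanishes j (∤j ∘ subst (_∣ j) (sym 1+n≡a)))
            (λ x → trans (cong (λ t → A.weight x * x ^ t) 1+n≡a) (A.weight-order x))
            (ξ ^ g) (λ j 1≤j → trans (cong (λ t → A.S (t ℕ.+ j)) g≡) (S-shift j 1≤j))
            (λ S≡0 → ξ^g≢0 (begin
              ξ ^ g             ≡⟨ solve 1 (λ t → t := :- (:- t)) refl (ξ ^ g) ⟩
              - (- (ξ ^ g))     ≡⟨ cong (λ t → - t) (S-g (ℕ.≤-trans (s≤s (s≤s z≤n)) 4≤a)) ⟨
              - A.S g           ≡⟨ cong (λ t → - A.S t) g≡ ⟨
              - A.S (suc n ℕ.* k) ≡⟨ cong (λ t → - t) S≡0 ⟩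
              - 0#              ≡⟨ solve 0 (:- nat 0 := nat 0) refl ⟩
              0#                ∎))
            using (k≮n; k≢n)

-- The counting identity and the dichotomy, with explicit constants

open import Data.Nat.Base using (_*_; _^_)
open import Defs using (0#; _⊖_; _⊙_; _⊚_; _≐_⊔_)
open import Relation.Unary using (_∈_; ｛_｝)

theorem4 : ∃[ K ] ∃[ C ]
    ((p : ℕ) .{{_ : NonZero p}} → Prime p →
    (A Γ : Subset p) → IsMultiplicativeSubgroup A → IsMultiplicativeSubgroup Γ →
    (ξ : 𝔽 p) → ξ ≢ 0# →
    A ⊖ A ≐ ξ ⊙ Γ ⊔ ｛ 0# ｝ →
    (c : ℕ) → (∀ x → x ∈ ξ ⊙ Γ → (A ⊚ A) x ≡ c) →
    (∣ A ∣ ^ 2 ∸ ∣ A ∣ ≡ c * ∣ Γ ∣) ×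
    -- p / log p ≤ C |Γ|; changing log p to ⌊log₂ p⌋ only affects C, as p ≥ 2.
    (∣ Γ ∣ ≤ K ⊎ p ≤ C * (∣ Γ ∣ * ⌊log₂ p ⌋)))
-- The 6 comes from `a ≤ 3`: then `a² = a + c g ≤ 3 a`, so `g ≤ c g ≤ 2 a ≤ 6`. The 2 comes from
-- `p ≤ 2 g`, where the logarithm only has to be at least 1.
theorem4 = 6 , 2 , λ p prime A Γ A-subgroup Γ-subgroup ξ ξ≢0 A⊖A≐ c A⊚A≡c →
  let open PrimeField p prime using (1<p)
      open PrimeField.Difference p prime A-subgroup Γ-subgroup ξ≢0 A⊖A≐
      a = ∣ A ∣
      g = ∣ Γ ∣
      a²≡ = counting c A⊚A≡c
      -- The lower end is `⌊log₂ 2 ⌋`, which computes to 1.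
      1≤log = ⌊log₂⌋-mono-≤ 1<p
      g≤cg = ℕ.m≤n*m g c {{ℕ.>-nonZero (c≥1 c A⊚A≡c)}}
  in trans (cong (_∸ a) (trans (cong (a *_) (ℕ.*-identityʳ a)) a²≡)) (ℕ.m+n∸m≡n a (c * g)) ,
     (case (p ℕ.≤? 2 * g) of λ where
       (yes p≤2g) → inj₂ (ℕ.≤-trans p≤2g (ℕ.*-monoʳ-≤ 2 (ℕ.m≤m*n g ⌊log₂ p ⌋ {{ℕ.>-nonZero 1≤log}})))
       (no p≰2g) → inj₁ (case (4 ℕ.≤? a) of λ where
         (yes 4≤a) → contradiction (ℕ.≰⇒> p≰2g) (excluded c A⊚A≡c 4≤a)
         (no 4≰a)  → ℕ.≤-trans g≤cg (ℕ.≤-trans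
           (ℕ.+-cancelˡ-≤ a (c * g) (2 * a)
             (ℕ.≤-trans (ℕ.≤-reflexive (sym a²≡)) (ℕ.*-monoˡ-≤ a (ℕ.≤-pred (ℕ.≰⇒> 4≰a)))))
           (ℕ.*-monoʳ-≤ 2 (ℕ.≤-pred (ℕ.≰⇒> 4≰a))))))
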